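{- (i) For every integer $s\ge 1$, as $k\to\infty$, $La([k]^2,\vee_s)=\left(k_s+\frac{c_s}{k_s+1}+o(1)\right)k$. (ii) For all integers $k,l\ge 1$, $La^*([k]\times[l],\vee_2)=k+l-1$. (iii) For all integers $k,l\ge 2$, $La^*([k]\times[l],\vee_3)=2(k+l)-4$. (iv) For integers $s\ge 1$ and $k$, $La^*([k]^2,\vee_s)\ge 2(s-1)k-O(s^2)$. (v) For all integers $k,l\ge 1$, $La^*([k]\times[l],\{\vee_2,\wedge_2\})=k+l-1$.
   Context: $[k]\times[l]$ and $[k]^2$ (where $[k]=\{1,\dots,k\}$) carry the coordinatewise order. For $s\ge 1$, $\vee_s$ is the poset on $s+1$ elements $a,b_1,\dots,b_s$ whose only relations are $a<b_i$ for all $i$; $\wedge_2$ is the poset on elements $a,b_1,b_2$ whose only relations are $b_1<a$, $b_2<a$. A poset $P$ is a weak subposet of $R$ if there is an injection $i:P\to R$ with $p\le_P p'\Rightarrow i(p)\le_R i(p')$; it is a strong subposet if moreover $p\le_P p'\iff i(p)\le_R i(p')$. A subset $F$ of a poset $Q$ is weak/strong $P$-free if $P$ is not a weak/strong subposet of $F$ (with induced order); for a family of posets, strong $\{P_1,P_2\}$-free means strong $P_1$-free and strong $P_2$-free. $La(Q,P)$, $La^*(Q,P)$ denote the maximum size of a weak, respectively strong, $P$-free subset of $Q$ (and similarly for a family). For $s\ge 1$, $k_s$ is the largest integer $k\ge 1$ with $\sum_{j=2}^{k}j<s$ (the empty sum being $0$), and $c_s=s-1-\sum_{j=2}^{k_s}j$;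 in particular $k_2=c_2=1$. -}

module Defs where

open import Data.Nat using (ℕ; zero; suc; _+_; _*_; _∸_; _≤_; _<_)
open import Data.Fin using (Fin) renaming (_≤_ to _≤ᶠ_; zero to fzero)
open import Data.Product using (Σ; ∃; _×_; _,_)
open import Data.Sum using (_⊎_)
open import Data.List using (List; length)
open import Data.List.Membership.Propositional using (_∈_)
open import Data.List.Relation.Unary.Unique.Propositional using (Unique)
open import Relation.Nullary using (¬_)
open import Relation.Binary.PropositionalEquality using (_≡_)
open import Function.Definitions using (Injective)
open import Function.Bundles using (_⇔_)

-- The grid [k] × [l], with element (x , y) ∈ Fin k × Fin l standing for (x+1 , y+1).
Grid : ℕ → ℕ → Set
Grid k l = Fin k × Fin l

_≼_ : ∀ {k l} → Grid k l → Grid k l → Set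
(x , y) ≼ (x′ , y′) = (x ≤ᶠ x′) × (y ≤ᶠ y′)

PosetRel : ℕ → Set₁
PosetRel n = Fin n → Fin n → Set

-- ∨_s on s+1 elements: a = fzero, b_i = the others; only relations a < b_i.
vee : (s : ℕ) → PosetRel (suc s)
vee s i j = (i ≡ j) ⊎ (i ≡ fzero)

-- ∧_2 on 3 elements: a = fzero; only relations b_i < a.
wedge2 : PosetRel 3
wedge2 i j = (i ≡ j) ⊎ (j ≡ fzero)

WeakCopy : ∀ {n k l} → PosetRel n → List (Grid k l) → Set
WeakCopy {n} {k} {l} P F =
  Σ (Fin n → Grid k l) λ f →
    Injective _≡_ _≡_ f × (∀ i → f i ∈ F) × (∀ i j → P i j → f i ≼ f j)

StrongCopy : ∀ {n k l} → PosetRel n → List (Grid k l) → Set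
StrongCopy {n} {k} {l} P F =
  Σ (Fin n → Grid k l) λ f →
    Injective _≡_ _≡_ f × (∀ i → f i ∈ F) × (∀ i j → P i j ⇔ (f i ≼ f j))

WeakFree : ∀ {n k l} → PosetRel n → List (Grid k l) → Set
WeakFree P F = ¬ WeakCopy P F

StrongFree : ∀ {n k l} → PosetRel n → List (Grid k l) → Set
StrongFree P F = ¬ StrongCopy P F

IsMaxSize : (k l : ℕ) → (List (Grid k l) → Set) → ℕ → Set
IsMaxSize k l Good m =
  (∃ λ F → Unique F × Good F × length F ≡ m) ×
  (∀ F → Unique F → Good F → length F ≤ m)

IsLa : ∀ {n} (k l : ℕ) → PosetRel n → ℕ → Set
IsLa k l P m = IsMaxSize k l (WeakFree P) m

IsLaStar : ∀ {n} (k l : ℕ) → PosetRel n → ℕ → Set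
IsLaStar k l P m = IsMaxSize k l (StrongFree P) m

IsLaStar₂ : ∀ {n₁ n₂} (k l : ℕ) → PosetRel n₁ → PosetRel n₂ → ℕ → Set
IsLaStar₂ k l P₁ P₂ m = IsMaxSize k l (λ F → StrongFree P₁ F × StrongFree P₂ F) m

S : ℕ → ℕ
S zero = 0
S (suc zero) = 0
S (suc (suc n)) = S (suc n) + suc (suc n)

IsKs : ℕ → ℕ → Set
IsKs s k = (1 ≤ k) × (S k < s) × (∀ k′ → 1 ≤ k′ → S k′ < s → k′ ≤ k)

cs : ℕ → ℕ → ℕ
cs s k = s ∸ 1 ∸ S k

{-# OPTIONS --safe #-}
-- Parts (ii) and (v). If F is strong ∨_2-free, no point of F has both a point of F above it in its
-- column and one to the right in its row. So each point is labelled either by its column (if it is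
-- the topmost one there) or by its row, which is then not the top row.
--
-- Part (iii). Call a point of F inner if it has both neighbours; the others are labelled as before.
-- The topmost inner point of a column is labelled by that column. Any other inner point (z, y), with
-- next inner point (z, y′) above it, is labelled by a gap between two consecutive rows in [y, y′]
-- that is not straddled by the inner points of any column to the left of z. Such a gap exists: if
-- columns to the left straddled all of them, let x₀ be one having inner points w₀ ≤ y < v₀ with v₀
-- maximal, and T its highest point in F. Strong ∨_3-freeness gives T ≤ y′, and following straddling
-- columns upwards from v₀ one never gets above height T.
--
-- Part (i), upper bound. Count pairs (t, q) with 0 ≤ t ≤ d and q = (x, y) in F. If some point of F
-- in columns ≤ x − t has height ≤ y, then so has the lowest point p of these columns, and p has
-- fewer than s points above it: at most sk pairs. Otherwise q is determined by t, x mod t and y: at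
-- most k(1 + … + d) pairs. Hence (d + 1)|F| ≤ k(s + d(d + 1)/2), which for d = k_s is the claimed
-- density. For the lower bound take d full antidiagonals and a fraction c_s/(d + 1) of the next one.
--
-- Part (iv). The points with 0 ≤ x − y < 2(s − 1) form s − 1 chains.
module Submission where

open import Defs
open import Data.Nat using (ℕ; zero; suc; _+_; _*_; _∸_; _≤_; _<_; z≤n; s≤s)
open import Data.Nat.Properties
open import Data.Nat.DivMod using (_%_; m≡m%n+[m/n]*n; m%n<n; m/n*n≤m; m<n*o⇒m/o<n; [m+kn]%n≡m%n; m<n⇒m%n≡m) renaming (_/_ to _/ℕ_)
open import Data.Nat.Tactic.RingSolver using (solve-∀)
open import Data.Integer using (+_; +[1+_])
import Data.Integer as ℤ
import Data.Integer.Properties as ℤₚ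
open import Data.Rational using (ℚ; mkℚ; _/_; ∣_∣; _-_; 0ℚ; toℚᵘ; *<*) renaming (_*_ to _*ℚ_; _≤_ to _≤ℚ_; _<_ to _<ℚ_; _+_ to _+ℚ_; -_ to -ℚ_)
open import Data.Rational.Properties using (toℚᵘ-injective; toℚᵘ-fromℚᵘ; fromℚᵘ-toℚᵘ; toℚᵘ-homo-*; toℚᵘ-homo-+; toℚᵘ-cancel-≤; ∣-p∣≡∣p∣; 0≤p⇒∣p∣≡p)
import Data.Rational.Properties as ℚₚ
open import Data.Rational.Unnormalised using (mkℚᵘ) renaming (_≃_ to _≃ᵘ_; _*_ to _*ᵘ_; _+_ to _+ᵘ_; *≡* to *≡*ᵘ; *≤* to *≤*ᵘ)
import Data.Rational.Unnormalised.Properties as ℚᵘₚ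
open import Data.Fin using (Fin; toℕ; fromℕ<; inject≤) renaming (zero to fzero; suc to fsuc)
import Data.Fin.Properties as Finₚ
open import Data.Product using (∃; _×_; _,_; proj₁; proj₂)
open import Data.Sum using (_⊎_; inj₁; inj₂)
open import Data.Sum.Properties using (inj₁-injective; inj₂-injective)
open import Data.Empty using (⊥; ⊥-elim)
open import Data.List using (List; []; _∷_; length; map; _++_; filter; lookup; tabulate; upTo; allFin; cartesianProduct)
open import Data.List.Properties using (length-map; length-++; length-tabulate; length-upTo)
open import Data.List.Membership.Propositional using (_∈_; find; lose)
open import Data.List.Membership.Propositional.Properties
open import Data.List.Relation.Unary.Any using (here; there; index; any?)
open import Data.List.Relation.Unary.Any.Properties using (lookup-index)
import Data.List.Relation.Unary.All as All
open import Data.List.Relation.Unary.AllPairs using (_∷_)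
open import Data.List.Relation.Unary.Unique.Propositional using (Unique)
import Data.List.Relation.Unary.Unique.Propositional.Properties as Uniq
open import Function.Bundles using (mk⇔; Equivalence)
open import Function.Definitions using (Injective)
open import Relation.Nullary using (¬_; Dec; yes; no)
open import Relation.Nullary.Decidable using (_×-dec_; _⊎-dec_; ¬?; map′; decidable-stable)
open import Relation.Unary using (Decidable)
open import Relation.Binary.Definitions using (tri<; tri≈; tri>)
open import Relation.Binary.PropositionalEquality using (_≡_; _≢_; refl; sym; trans; cong; cong₂; subst; subst₂; module ≡-Reasoning)

-- Counting with lists

lookup-injective : ∀ {A : Set} {xs : List A} → Unique xs → Injective _≡_ _≡_ (lookup xs)
lookup-injective (_ ∷ _)  {fzero}  {fzero}  _  = refl
lookup-injective (x∉ ∷ _) {fzero}  {fsuc j} eq = ⊥-elim (All.lookup x∉ (∈-lookup j) eq)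
lookup-injective (x∉ ∷ _) {fsuc i} {fzero}  eq = ⊥-elim (All.lookup x∉ (∈-lookup i) (sym eq))
lookup-injective (_ ∷ u)  {fsuc i} {fsuc j} eq = cong fsuc (lookup-injective u eq)

-- Each entry of `xs` picks the position of one of its labels in `ys`, and the last hypothesis makes
-- this choice injective. Since `R` is a relation, an entry may admit several labels, one of them
-- found by case analysis.
length-≤-by-relation : ∀ {A B : Set} {xs : List A} {ys : List B} (R : A → B → Set) → Unique xs →
  (∀ {x} → x ∈ xs → ∃ λ y → y ∈ ys × R x y) →
  (∀ {x x′ y} → x ∈ xs → x′ ∈ xs → R x y → R x′ y → x ≡ x′) →
  length xs ≤ length ys
length-≤-by-relation {xs = xs} {ys} R uniq total inj = Finₚ.injective⇒≤ {f = label} label-injective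
  where
  choice : ∀ i → ∃ λ y → y ∈ ys × R (lookup xs i) y
  choice i = total (∈-lookup i)

  label : Fin (length xs) → Fin (length ys)
  label i = index (proj₁ (proj₂ (choice i)))

  label-injective : Injective _≡_ _≡_ label
  label-injective {i} {j} eq = lookup-injective uniq
    (inj (∈-lookup i) (∈-lookup j) (proj₂ (proj₂ (choice i)))
      (subst (R (lookup xs j)) (sym same) (proj₂ (proj₂ (choice j)))))
    where
    same : proj₁ (choice i) ≡ proj₁ (choice j)
    same = trans (lookup-index (proj₁ (proj₂ (choice i))))
      (trans (cong (lookup ys) eq) (sym (lookup-index (proj₁ (proj₂ (choice j))))))

length-cartesianProduct : ∀ {A B : Set} (xs : List A) (ys : List B) →
  length (cartesianProduct xs ys) ≡ length xs * length ys
length-cartesianProduct []       ys = refl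
length-cartesianProduct (x ∷ xs) ys = trans (length-++ (map (x ,_) ys))
  (cong₂ _+_ (length-map (x ,_) ys) (length-cartesianProduct xs ys))

infixr 5 _⊕_

_⊕_ : ∀ {A B : Set} → List A → List B → List (A ⊎ B)
xs ⊕ ys = map inj₁ xs ++ map inj₂ ys

length-⊕ : ∀ {A B : Set} (xs : List A) (ys : List B) → length (xs ⊕ ys) ≡ length xs + length ys
length-⊕ xs ys = trans (length-++ (map inj₁ xs)) (cong₂ _+_ (length-map inj₁ xs) (length-map inj₂ ys))

∈-⊕⁺ˡ : ∀ {A B : Set} {xs : List A} {ys : List B} {x} → x ∈ xs → inj₁ x ∈ xs ⊕ ys
∈-⊕⁺ˡ x∈ = ∈-++⁺ˡ (∈-map⁺ inj₁ x∈)

∈-⊕⁺ʳ : ∀ {A B : Set} {xs : List A} {ys : List B} {y} → y ∈ ys → inj₂ y ∈ xs ⊕ ys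
∈-⊕⁺ʳ {xs = xs} y∈ = ∈-++⁺ʳ (map inj₁ xs) (∈-map⁺ inj₂ y∈)

∈-⊕⁻ˡ : ∀ {A B : Set} {xs : List A} {ys : List B} {x} → inj₁ x ∈ xs ⊕ ys → x ∈ xs
∈-⊕⁻ˡ {xs = xs} x∈ with ∈-++⁻ (map inj₁ xs) x∈
... | inj₁ q with _ , p , refl ← ∈-map⁻ inj₁ q = p
... | inj₂ q with _ , _ , () ← ∈-map⁻ inj₂ q

∈-⊕⁻ʳ : ∀ {A B : Set} {xs : List A} {ys : List B} {y} → inj₂ y ∈ xs ⊕ ys → y ∈ ys
∈-⊕⁻ʳ {xs = xs} y∈ with ∈-++⁻ (map inj₁ xs) y∈
... | inj₁ q with _ , _ , () ← ∈-map⁻ inj₁ q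
... | inj₂ q with _ , p , refl ← ∈-map⁻ inj₂ q = p

⊕-unique : ∀ {A B : Set} {xs : List A} {ys : List B} → Unique xs → Unique ys → Unique (xs ⊕ ys)
⊕-unique {xs = xs} {ys} ux uy = Uniq.++⁺ (Uniq.map⁺ inj₁-injective ux) (Uniq.map⁺ inj₂-injective uy) disjoint
  where
  disjoint : ∀ {z} → ¬ (z ∈ map inj₁ xs × z ∈ map inj₂ ys)
  disjoint (p , q) with ∈-map⁻ inj₁ p | ∈-map⁻ inj₂ q
  ... | _ , _ , refl | _ , _ , ()

m<n∸o⇒o+m<n : ∀ {m} n o → m < n ∸ o → o + m < n
m<n∸o⇒o+m<n {m} n o m< = subst (_< n) (+-comm m o) (m≤o∸n⇒m+n≤o (suc m) o≤n m<)
  where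
  o≤n : o ≤ n
  o≤n = <⇒≤ (m∸n≢0⇒n<m λ eq → <⇒≱ (subst (m <_) eq m<) z≤n)

-- Bounded search

greatest : ∀ {P : ℕ → Set} (P? : Decidable P) n →
  (∀ {m} → m < n → ¬ P m) ⊎ (∃ λ m → P m × (∀ {j} → j < n → P j → j ≤ m))
greatest P? zero = inj₁ λ ()
greatest {P} P? (suc n) with P? n
... | yes p = inj₂ (n , p , λ j<n _ → ≤-pred j<n)
... | no ¬p with greatest P? n
... | inj₁ none = inj₁ λ m<n pm → none (≤∧≢⇒< (≤-pred m<n) (λ { refl → ¬p pm })) pm
... | inj₂ (m , pm , max) = inj₂ (m , pm , λ j<n pj → max (≤∧≢⇒< (≤-pred j<n) (λ { refl → ¬p pj })) pj)

least : ∀ {P : ℕ → Set} (P? : Decidable P) {n} → P n →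
  ∃ λ m → P m × m ≤ n × (∀ {j} → j < m → ¬ P j)
least {P} P? {n} pn = go 0 n refl λ ()
  where
  go : ∀ a b → a + b ≡ n → (∀ {j} → j < a → ¬ P j) → ∃ λ m → P m × m ≤ n × (∀ {j} → j < m → ¬ P j)
  go a zero    eq none = n , pn , ≤-refl , λ j<n → none (subst (_ <_) (sym (trans (sym (+-identityʳ a)) eq)) j<n)
  go a (suc b) eq none with P? a
  ... | yes pa = a , pa , subst (a ≤_) eq (m≤m+n a (suc b)) , none
  ... | no ¬pa = go (suc a) b (trans (sym (+-suc a b)) eq) below
    where
    below : ∀ {j} → j < suc a → ¬ P j
    below j≤a pj with m≤n⇒m<n∨m≡n (≤-pred j≤a)
    ... | inj₁ j<a  = none j<a pj
    ... | inj₂ refl = ¬pa pj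

-- Points of the grid

X : ∀ {k l} → Grid k l → ℕ
X (x , _) = toℕ x

Y : ∀ {k l} → Grid k l → ℕ
Y (_ , y) = toℕ y

point-≡ : ∀ {k l} {p q : Grid k l} → X p ≡ X q → Y p ≡ Y q → p ≡ q
point-≡ eqx eqy = cong₂ _,_ (Finₚ.toℕ-injective eqx) (Finₚ.toℕ-injective eqy)

≼-antisym : ∀ {k l} {p q : Grid k l} → p ≼ q → q ≼ p → p ≡ q
≼-antisym (a , b) (c , d) = point-≡ (≤-antisym a c) (≤-antisym b d)

_≼?_ : ∀ {k l} (p q : Grid k l) → Dec (p ≼ q)
p ≼? q = (X p ≤? X q) ×-dec (Y p ≤? Y q)

_≟ᴳ_ : ∀ {k l} (p q : Grid k l) → Dec (p ≡ q)
p ≟ᴳ q = map′ (λ (a , b) → point-≡ a b) (λ { refl → refl , refl }) ((X p ≟ X q) ×-dec (Y p ≟ Y q))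

At : ∀ {k l} → List (Grid k l) → ℕ → ℕ → Set
At {k} {l} F x y = ∃ λ p → p ∈ F × X p ≡ x × Y p ≡ y

module _ {k l : ℕ} {F : List (Grid k l)} where

  at : ∀ {p} → p ∈ F → At F (X p) (Y p)
  at p∈ = _ , p∈ , refl , refl

  At⇒X< : ∀ {x y} → At F x y → x < k
  At⇒X< (p , _ , refl , _) = Finₚ.toℕ<n (proj₁ p)

  At⇒Y< : ∀ {x y} → At F x y → y < l
  At⇒Y< (p , _ , _ , refl) = Finₚ.toℕ<n (proj₂ p)

At? : ∀ {k l} (F : List (Grid k l)) x y → Dec (At F x y)
At? []      x y = no λ ()
At? (p ∷ F) x y with (X p ≟ x) ×-dec (Y p ≟ y) | At? F x y
... | yes (a , b) | _ = yes (p , here refl , a , b)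
... | no _  | yes (q , q∈ , r) = yes (q , there q∈ , r)
... | no ¬a | no ¬b = no λ { (q , here refl , r) → ¬a r ; (q , there q∈ , r) → ¬b (q , q∈ , r) }

module Region (k l : ℕ) {P : ℕ → ℕ → Set} (P? : ∀ x y → Dec (P x y)) where

  region : List (Grid k l)
  region = filter (λ p → P? (X p) (Y p)) (cartesianProduct (allFin k) (allFin l))

  region-unique : Unique region
  region-unique = Uniq.filter⁺ (λ p → P? (X p) (Y p)) (Uniq.cartesianProduct⁺ (Uniq.allFin⁺ k) (Uniq.allFin⁺ l))

  region⁻ : ∀ {p} → p ∈ region → P (X p) (Y p)
  region⁻ p∈ = proj₂ (∈-filter⁻ (λ p → P? (X p) (Y p)) {xs = cartesianProduct (allFin k) (allFin l)} p∈)

  region⁺ : ∀ {x y} → x < k → y < l → P x y → ∃ λ p → p ∈ region × X p ≡ x × Y p ≡ y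
  region⁺ {x} {y} x<k y<l pxy = (fromℕ< x<k , fromℕ< y<l)
    , ∈-filter⁺ (λ p → P? (X p) (Y p)) (∈-cartesianProduct⁺ (∈-allFin _) (∈-allFin _))
        (subst (λ a → P a _) (sym eqx) (subst (P x) (sym eqy) pxy))
    , eqx , eqy
    where
    eqx = Finₚ.toℕ-fromℕ< x<k
    eqy = Finₚ.toℕ-fromℕ< y<l

  -- The families giving the lower bounds are all regions; an injective parametrization by
  -- coordinates then bounds their size from below.
  region-size : ∀ {A : Set} {xs : List A} → Unique xs → (f : A → ℕ × ℕ) →
    (∀ {a} → a ∈ xs → proj₁ (f a) < k × proj₂ (f a) < l × P (proj₁ (f a)) (proj₂ (f a))) →
    (∀ {a b} → a ∈ xs → b ∈ xs → f a ≡ f b → a ≡ b) →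
    length xs ≤ length region
  region-size uniq f inside inj = length-≤-by-relation (λ a p → X p ≡ proj₁ (f a) × Y p ≡ proj₂ (f a)) uniq
    (λ a∈ → let (x< , y< , pf) = inside a∈ in region⁺ x< y< pf)
    (λ a∈ b∈ (a₁ , a₂) (b₁ , b₂) → inj a∈ b∈ (cong₂ _,_ (trans (sym a₁) b₁) (trans (sym a₂) b₂)))

-- Copies of ∨_s and ∧_2

-- The leaves run from upper left to lower right, hence are pairwise incomparable and in particular
-- distinct.
strongCopy : ∀ {k l s} {F : List (Grid k l)} {d : Grid k l} (g : Fin s → Grid k l) →
  d ∈ F → (∀ i → g i ∈ F) → (∀ i → d ≼ g i) → (∀ i → d ≢ g i) →
  (∀ {i j} → toℕ i < toℕ j → X (g i) < X (g j) × Y (g j) < Y (g i)) →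
  StrongCopy (vee s) F
strongCopy {k} {l} {s} {F} {d} g d∈ g∈ d≼ d≢ anti = f , f-injective , f∈ , λ i j → mk⇔ (to i j) (from i j)
  where
  f : Fin (suc s) → Grid k l
  f fzero    = d
  f (fsuc i) = g i

  f∈ : ∀ i → f i ∈ F
  f∈ fzero    = d∈
  f∈ (fsuc i) = g∈ i

  comparable⇒≡ : ∀ i j → g i ≼ g j → i ≡ j
  comparable⇒≡ i j (a , b) with <-cmp (toℕ i) (toℕ j)
  ... | tri< i<j _ _ = ⊥-elim (<⇒≱ (proj₂ (anti i<j)) b)
  ... | tri≈ _ eq _  = Finₚ.toℕ-injective eq
  ... | tri> _ _ j<i = ⊥-elim (<⇒≱ (proj₁ (anti j<i)) a)

  f-injective : Injective _≡_ _≡_ f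
  f-injective {fzero}  {fzero}  _  = refl
  f-injective {fzero}  {fsuc j} eq = ⊥-elim (d≢ j eq)
  f-injective {fsuc i} {fzero}  eq = ⊥-elim (d≢ i (sym eq))
  f-injective {fsuc i} {fsuc j} eq = cong fsuc (comparable⇒≡ i j (subst (g i ≼_) eq (≤-refl , ≤-refl)))

  to : ∀ i j → vee s i j → f i ≼ f j
  to i        .i       (inj₁ refl) = ≤-refl , ≤-refl
  to .fzero   fzero    (inj₂ refl) = ≤-refl , ≤-refl
  to .fzero   (fsuc j) (inj₂ refl) = d≼ j

  from : ∀ i j → f i ≼ f j → vee s i j
  from fzero    j        _ = inj₂ refl
  from (fsuc i) fzero    q = ⊥-elim (d≢ i (≼-antisym (d≼ i) q))
  from (fsuc i) (fsuc j) q = inj₁ (cong fsuc (comparable⇒≡ i j q))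

module _ {k l : ℕ} {F : List (Grid k l)} where

  -- With the leaves listed from upper left to lower right, the root need only be compared with the
  -- column of the first and the row of the last; the other comparisons and its distinctness from
  -- both follow.
  vee2-free⇒ : StrongFree (vee 2) F → ∀ {x₀ y₀ x₁ y₁ x₂ y₂} →
    At F x₀ y₀ → At F x₁ y₁ → At F x₂ y₂ → x₀ ≤ x₁ → x₁ < x₂ → y₀ ≤ y₂ → y₂ < y₁ → ⊥
  vee2-free⇒ free (d , d∈ , refl , refl) (p , p∈ , refl , refl) (q , q∈ , refl , refl) x₀₁ x₁₂ y₀₂ y₂₁ =
    free (strongCopy g d∈ g∈ d≼ d≢ anti)
    where
    g : Fin 2 → Grid k l
    g fzero        = p
    g (fsuc fzero) = q
    g∈ : ∀ i → g i ∈ F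
    g∈ fzero        = p∈
    g∈ (fsuc fzero) = q∈
    d≼ : ∀ i → d ≼ g i
    d≼ fzero        = x₀₁ , ≤-trans y₀₂ (<⇒≤ y₂₁)
    d≼ (fsuc fzero) = ≤-trans x₀₁ (<⇒≤ x₁₂) , y₀₂
    d≢ : ∀ i → d ≢ g i
    d≢ fzero        refl = <⇒≱ y₂₁ y₀₂
    d≢ (fsuc fzero) refl = <⇒≱ x₁₂ x₀₁
    anti : ∀ {i j} → toℕ i < toℕ j → X (g i) < X (g j) × Y (g j) < Y (g i)
    anti {fzero}      {fsuc fzero} _ = x₁₂ , y₂₁
    anti {fzero}      {fzero}      ()
    anti {fsuc fzero} {fzero}      ()
    anti {fsuc fzero} {fsuc fzero} (s≤s ())

  vee3-free⇒ : StrongFree (vee 3) F → ∀ {x₀ y₀ x₁ y₁ x₂ y₂ x₃ y₃} →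
    At F x₀ y₀ → At F x₁ y₁ → At F x₂ y₂ → At F x₃ y₃ →
    x₀ ≤ x₁ → x₁ < x₂ → x₂ < x₃ → y₀ ≤ y₃ → y₃ < y₂ → y₂ < y₁ → ⊥
  vee3-free⇒ free (d , d∈ , refl , refl) (p , p∈ , refl , refl) (q , q∈ , refl , refl) (r , r∈ , refl , refl)
    x₀₁ x₁₂ x₂₃ y₀₃ y₃₂ y₂₁ = free (strongCopy g d∈ g∈ d≼ d≢ anti)
    where
    g : Fin 3 → Grid k l
    g fzero               = p
    g (fsuc fzero)        = q
    g (fsuc (fsuc fzero)) = r
    g∈ : ∀ i → g i ∈ F
    g∈ fzero               = p∈
    g∈ (fsuc fzero)        = q∈
    g∈ (fsuc (fsuc fzero)) = r∈
    d≼ : ∀ i → d ≼ g i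
    d≼ fzero               = x₀₁ , ≤-trans y₀₃ (<⇒≤ (<-trans y₃₂ y₂₁))
    d≼ (fsuc fzero)        = ≤-trans x₀₁ (<⇒≤ x₁₂) , ≤-trans y₀₃ (<⇒≤ y₃₂)
    d≼ (fsuc (fsuc fzero)) = ≤-trans x₀₁ (<⇒≤ (<-trans x₁₂ x₂₃)) , y₀₃
    d≢ : ∀ i → d ≢ g i
    d≢ fzero               refl = <⇒≱ (<-trans y₃₂ y₂₁) y₀₃
    d≢ (fsuc fzero)        refl = <⇒≱ x₁₂ x₀₁
    d≢ (fsuc (fsuc fzero)) refl = <⇒≱ (<-trans x₁₂ x₂₃) x₀₁
    anti : ∀ {i j} → toℕ i < toℕ j → X (g i) < X (g j) × Y (g j) < Y (g i)
    anti {fzero}             {fsuc fzero}        _ = x₁₂ , y₂₁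
    anti {fzero}             {fsuc (fsuc fzero)} _ = <-trans x₁₂ x₂₃ , <-trans y₃₂ y₂₁
    anti {fsuc fzero}        {fsuc (fsuc fzero)} _ = x₂₃ , y₃₂
    anti {fsuc fzero}        {fsuc fzero}        (s≤s ())
    anti {fsuc (fsuc fzero)} {fsuc fzero}        (s≤s ())
    anti {fsuc (fsuc fzero)} {fsuc (fsuc fzero)} (s≤s (s≤s ()))

  -- A set covered by t chains has no antichain of size t + 1.
  module _ (colour : Grid k l → ℕ) {t : ℕ} (colour< : ∀ {p} → p ∈ F → colour p < t)
    (chain : ∀ {p q} → p ∈ F → q ∈ F → colour p ≡ colour q → p ≼ q ⊎ q ≼ p) where

    chains⇒vee-free : StrongFree (vee (suc t)) F
    chains⇒vee-free (f , _ , f∈ , iff) = 1+n≰n (Finₚ.injective⇒≤ {f = c} c-injective)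
      where
      c : Fin (suc t) → Fin t
      c i = fromℕ< (colour< (f∈ (fsuc i)))

      c-injective : Injective _≡_ _≡_ c
      c-injective {i} {j} eq with chain (f∈ (fsuc i)) (f∈ (fsuc j)) (Finₚ.fromℕ<-injective _ _ _ _ eq)
      ... | inj₁ i≼j with Equivalence.from (iff (fsuc i) (fsuc j)) i≼j
      ...   | inj₁ eq′ = Finₚ.suc-injective eq′
      c-injective {i} {j} eq | inj₂ j≼i with Equivalence.from (iff (fsuc j) (fsuc i)) j≼i
      ...   | inj₁ eq′ = sym (Finₚ.suc-injective eq′)

  chain⇒wedge-free : (∀ {p q} → p ∈ F → q ∈ F → p ≼ q ⊎ q ≼ p) → StrongFree wedge2 F
  chain⇒wedge-free chain (f , _ , f∈ , iff) with chain (f∈ (fsuc fzero)) (f∈ (fsuc (fsuc fzero)))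
  ... | inj₁ q with Equivalence.from (iff (fsuc fzero) (fsuc (fsuc fzero))) q
  ...   | inj₁ ()
  ...   | inj₂ ()
  chain⇒wedge-free chain (f , _ , f∈ , iff) | inj₂ q with Equivalence.from (iff (fsuc (fsuc fzero)) (fsuc fzero)) q
  ...   | inj₁ ()
  ...   | inj₂ ()

-- Upper bounds for ∨_2 and ∨_3

module UpRight {k l : ℕ} (F : List (Grid k l)) where

  -- The explicit bounds on `t` and `r` turn each predicate into a bounded search, hence decidable.
  Up Right Inner : ℕ → ℕ → Set
  Up x y    = ∃ λ t → t < l × y < t × At F x t
  Right x y = ∃ λ r → r < k × x < r × At F r y
  Inner x y = At F x y × Up x y × Right x y

  Up? : ∀ x y → Dec (Up x y)
  Up? x y = anyUpTo? (λ t → (y <? t) ×-dec At? F x t) l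

  Right? : ∀ x y → Dec (Right x y)
  Right? x y = anyUpTo? (λ r → (x <? r) ×-dec At? F r y) k

  Inner? : ∀ x y → Dec (Inner x y)
  Inner? x y = At? F x y ×-dec (Up? x y ×-dec Right? x y)

  data Outer (p : Grid k l) : ℕ ⊎ ℕ → Set where
    topmost   : ¬ Up (X p) (Y p) → Outer p (inj₁ (X p))
    rightmost : ¬ Right (X p) (Y p) → Outer p (inj₂ (Y p))

  outerLabels : List (ℕ ⊎ ℕ)
  outerLabels = upTo k ⊕ upTo (l ∸ 1)

  length-outerLabels : length outerLabels ≡ k + (l ∸ 1)
  length-outerLabels = trans (length-⊕ (upTo k) (upTo (l ∸ 1))) (cong₂ _+_ (length-upTo k) (length-upTo (l ∸ 1)))

  -- A point with a point above it does not lie in the top row; this saves one row label.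
  outer-label : ∀ {p} → p ∈ F → ¬ Inner (X p) (Y p) → ∃ λ b → b ∈ outerLabels × Outer p b
  outer-label {p} p∈ ¬inner with Up? (X p) (Y p) | Right? (X p) (Y p)
  ... | no ¬up | _         = _ , ∈-⊕⁺ˡ (∈-upTo⁺ (At⇒X< (at p∈))) , topmost ¬up
  ... | yes (t , t<l , y<t , _) | no ¬right =
    _ , ∈-⊕⁺ʳ {xs = upTo k} (∈-upTo⁺ (≤-trans y<t (∸-monoˡ-≤ 1 t<l))) , rightmost ¬right
  ... | yes up | yes right = ⊥-elim (¬inner (at p∈ , up , right))

  outer-injective : ∀ {p q b} → p ∈ F → q ∈ F → Outer p b → Outer q b → p ≡ q
  outer-injective {p} {q} p∈ q∈ op oq = go op oq refl
    where
    -- The index `X p` is not in constructor form, so the equality of the two labels is kept as an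
    -- explicit equation.
    go : ∀ {b c} → Outer p b → Outer q c → b ≡ c → p ≡ q
    go (topmost ¬p) (topmost ¬q) eq with inj₁-injective eq | <-cmp (Y p) (Y q)
    ... | eqx | tri< lt _ _ = ⊥-elim (¬p (Y q , At⇒Y< (at q∈) , lt , q , q∈ , sym eqx , refl))
    ... | eqx | tri≈ _ e _  = point-≡ eqx e
    ... | eqx | tri> _ _ gt = ⊥-elim (¬q (Y p , At⇒Y< (at p∈) , gt , p , p∈ , eqx , refl))
    go (rightmost ¬p) (rightmost ¬q) eq with inj₂-injective eq | <-cmp (X p) (X q)
    ... | eqy | tri< lt _ _ = ⊥-elim (¬p (X q , At⇒X< (at q∈) , lt , q , q∈ , refl , sym eqy))
    ... | eqy | tri≈ _ e _  = point-≡ e eqy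
    ... | eqy | tri> _ _ gt = ⊥-elim (¬q (X p , At⇒X< (at p∈) , gt , p , p∈ , refl , eqy))
    go (topmost _) (rightmost _) ()
    go (rightmost _) (topmost _) ()

vee2-upper : ∀ {k l} → 1 ≤ l → (F : List (Grid k l)) → Unique F → StrongFree (vee 2) F → length F ≤ k + l ∸ 1
vee2-upper {k} {l} 1≤l F uniq free = subst (length F ≤_) (trans length-outerLabels (sym (+-∸-assoc k 1≤l)))
  (length-≤-by-relation Outer uniq (λ p∈ → outer-label p∈ no-inner) outer-injective)
  where
  open UpRight F
  no-inner : ∀ {x y} → ¬ Inner x y
  no-inner (a , (_ , _ , y<t , u) , (_ , _ , x<r , r)) = vee2-free⇒ free a u r ≤-refl x<r ≤-refl y<t

module Vee3Upper {k l : ℕ} (F : List (Grid k l)) (free : StrongFree (vee 3) F) where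

  open UpRight F

  ∨₃ : ∀ {x₀ y₀ x₁ y₁ x₂ y₂ x₃ y₃} → At F x₀ y₀ → At F x₁ y₁ → At F x₂ y₂ → At F x₃ y₃ →
    x₀ ≤ x₁ → x₁ < x₂ → x₂ < x₃ → y₀ ≤ y₃ → y₃ < y₂ → y₂ < y₁ → ⊥
  ∨₃ = vee3-free⇒ free

  Inner⇒Y< : ∀ {x y} → Inner x y → y < l ∸ 1
  Inner⇒Y< (_ , (_ , t<l , y<t , _) , _) = ≤-trans y<t (∸-monoˡ-≤ 1 t<l)

  Inner⇒X< : ∀ {x y} → Inner x y → x < k ∸ 1
  Inner⇒X< (_ , _ , (_ , r<k , x<r , _)) = ≤-trans x<r (∸-monoˡ-≤ 1 r<k)

  -- Gap g lies between rows g and g + 1.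
  Covers : ℕ → ℕ → Set
  Covers x g = (∃ λ w → w < suc g × Inner x w) × (∃ λ v → v < l × g < v × Inner x v)

  Covers? : ∀ x g → Dec (Covers x g)
  Covers? x g = anyUpTo? (Inner? x) (suc g) ×-dec anyUpTo? (λ v → (g <? v) ×-dec Inner? x v) l

  module _ {z y y′} (y<y′ : y < y′) (zy : Inner z y) (zy′ : Inner z y′)
    (covered : ∀ {g} → y ≤ g → g < y′ → ∃ λ x → x < z × Covers x g) where

    module _ {x₀ w₀ v₀ T} (x₀<z : x₀ < z) (x₀w₀ : Inner x₀ w₀) (w₀≤y : w₀ ≤ y)
      (y<v₀ : y < v₀) (x₀v₀ : Inner x₀ v₀)
      (v₀-max : ∀ {x w v} → x < z → Inner x w → w ≤ y → Inner x v → y < v → v ≤ v₀)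
      (x₀T : At F x₀ T) (T-max : ∀ {t} → At F x₀ t → t ≤ T) where

      -- Otherwise (x₀, T), (z, y′) and the right neighbour of (z, y) are an antichain above (x₀,
      -- w₀).
      T≤y′ : T ≤ y′
      T≤y′ = ≮⇒≥ λ y′<T → let (_ , _ , (_ , _ , z<r , r)) = zy in
        ∨₃ (proj₁ x₀w₀) x₀T (proj₁ zy′) r ≤-refl x₀<z z<r w₀≤y y<y′ y′<T

      -- Right of column x₀, such a point would form with (x₀, T) and (z, y) an antichain above (x₀,
      -- w₀).
      box-empty : ∀ {x w} → x < z → y < w → w < T → At F x w → x ≤ x₀
      box-empty x<z y<w w<T xw = ≮⇒≥ λ x₀<x →
        ∨₃ (proj₁ x₀w₀) x₀T xw (proj₁ zy) ≤-refl x₀<x x<z w₀≤y y<w w<T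

      -- Follow covering intervals upwards from v₀. All of them stay in columns m, …, x₀, whose
      -- points never exceed height T ≤ y′, so y′ is not reached.
      climb : ∀ n {m a v} → y′ ≤ v + n → Inner a v → v₀ ≤ v → m ≤ a → a ≤ x₀ →
        (∀ {x t} → m ≤ x → x ≤ x₀ → At F x t → t ≤ T) → ⊥
      climb n {m} {a} {v} y′≤ av@(_ , (tₐ , _ , v<tₐ , atₐ) , (_ , _ , a<r , r)) v₀≤v m≤a a≤x₀ low
        -- The upper neighbour of (a, v) has height at most T ≤ y′, so the gap just above v is among
        -- the covered ones.
        with tₐ≤T ← low m≤a a≤x₀ atₐ
        with covered {v} (≤-trans (<⇒≤ y<v₀) v₀≤v) (<-≤-trans v<tₐ (≤-trans tₐ≤T T≤y′))
      ... | x , x<z , (w , w≤v , xw) , (v′ , _ , v<v′ , xv′) = step n y′≤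
        where
        w≤v′ : w ≤ v
        w≤v′ = ≤-pred w≤v

        -- If w ≤ y, the maximality of v₀ would give v′ ≤ v₀, whereas v′ > v ≥ v₀.
        y<w : y < w
        y<w = ≰⇒> λ w≤y → <⇒≱ (<-≤-trans (s≤s v₀≤v) v<v′)
          (v₀-max x<z xw w≤y xv′ (<-trans (<-≤-trans y<v₀ v₀≤v) v<v′))

        x≤x₀ : x ≤ x₀
        x≤x₀ = box-empty x<z y<w (≤-<-trans w≤v′ (<-≤-trans v<tₐ tₐ≤T)) (proj₁ xw)

        -- For a new column b < m, a point (b, t) with t > T would form with (a, tₐ) and the right
        -- neighbour of (a, v) an antichain above (x, w).
        low′ : ∀ {b t} → x ≤ b → b ≤ x₀ → At F b t → t ≤ T
        low′ {b} x≤b b≤x₀ bt with m ≤? b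
        ... | yes m≤b = low m≤b b≤x₀ bt
        ... | no m≰b = ≮⇒≥ λ T<t →
          ∨₃ (proj₁ xw) bt atₐ r x≤b (<-≤-trans (≰⇒> m≰b) m≤a) a<r w≤v′ v<tₐ (≤-<-trans tₐ≤T T<t)

        -- The fuel n bounds y′ - v and decreases as v grows. It cannot reach zero, because v < tₐ ≤
        -- T ≤ y′.
        step : ∀ n → y′ ≤ v + n → ⊥
        step zero    y′≤ = <⇒≱ (<-≤-trans v<tₐ (≤-trans tₐ≤T T≤y′)) (≤-trans y′≤ (≤-reflexive (+-identityʳ v)))
        step (suc n) y′≤ with m ≤? x
        ... | yes m≤x = climb n (≤-trans y′≤ (≤-trans (≤-reflexive (+-suc v n)) (+-monoˡ-≤ n v<v′)))
          xv′ (≤-trans v₀≤v (<⇒≤ v<v′)) m≤x x≤x₀ low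
        ... | no m≰x  = climb n (≤-trans y′≤ (≤-trans (≤-reflexive (+-suc v n)) (+-monoˡ-≤ n v<v′)))
          xv′ (≤-trans v₀≤v (<⇒≤ v<v′)) ≤-refl x≤x₀ low′

    not-all-covered : ⊥
    not-all-covered with greatest start? l
      where
      -- The possible upper ends v of inner pairs straddling the lowest gap y in columns left of z;
      -- the greatest one is v₀.
      Start : ℕ → Set
      Start v = y < v × ∃ λ x → x < z × (∃ λ w → w < suc y × Inner x w) × Inner x v
      start? : Decidable Start
      start? v = (y <? v) ×-dec anyUpTo? (λ x → anyUpTo? (Inner? x) (suc y) ×-dec Inner? x v) z
    ... | inj₁ none with x , x<z , below , (v , v<l , y<v , xv) ← covered ≤-refl y<y′ =
      none v<l (y<v , x , x<z , below , xv)
    ... | inj₂ (v₀ , (y<v₀ , x₀ , x₀<z , (w₀ , w₀≤y , x₀w₀) , x₀v₀) , max) with greatest (At? F x₀) l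
    ...   | inj₁ none = none (At⇒Y< (proj₁ x₀v₀)) (proj₁ x₀v₀)
    -- The climb starts with m = a = x₀, where the height bound is the choice of T, and with fuel
    -- y′.
    ...   | inj₂ (T , x₀T , T-max) = climb x₀<z x₀w₀ (≤-pred w₀≤y) y<v₀ x₀v₀
      (λ x<z xw w≤y xv y<v → max (At⇒Y< (proj₁ xv)) (y<v , _ , x<z , (_ , s≤s w≤y , xw) , xv))
      x₀T (λ a → T-max (At⇒Y< a) a) y′ (m≤n+m y′ v₀) x₀v₀ ≤-refl ≤-refl ≤-refl
      λ { x₀≤x x≤x₀ a → T-max (At⇒Y< a) (subst (λ x → At F x _) (≤-antisym x≤x₀ x₀≤x) a) }

  -- Gaps and columns form a finite search space, so the contradiction above produces an actual gap.
  uncovered-gap : ∀ {z y y′} → y < y′ → Inner z y → Inner z y′ →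
    ∃ λ g → y ≤ g × g < y′ × (∀ {x} → x < z → ¬ Covers x g)
  uncovered-gap {z} {y} {y′} y<y′ zy zy′
    with anyUpTo? (λ g → (y ≤? g) ×-dec ¬? (anyUpTo? (λ x → Covers? x g) z)) y′
  ... | yes (g , g<y′ , y≤g , unc) = g , y≤g , g<y′ , λ x<z c → unc (_ , x<z , c)
  ... | no all = ⊥-elim (not-all-covered y<y′ zy zy′ λ {g} y≤g g<y′ →
    decidable-stable (anyUpTo? (λ x → Covers? x g) z) λ unc → all (g , g<y′ , y≤g , unc))

  TopInner : ℕ → ℕ → Set
  TopInner x y = ∀ {t} → y < t → ¬ Inner x t

  GapOf : ℕ → ℕ → ℕ → Set
  GapOf x y g = y ≤ g × (∃ λ t → g < t × Inner x t × (∀ {s} → y < s → s < t → ¬ Inner x s)) ×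
    (∀ {a} → a < x → ¬ Covers a g)

  data Label (p : Grid k l) : (ℕ ⊎ ℕ) ⊎ (ℕ ⊎ ℕ) → Set where
    outer : ∀ {b} → Outer p b → Label p (inj₁ b)
    top   : Inner (X p) (Y p) → TopInner (X p) (Y p) → Label p (inj₂ (inj₁ (X p)))
    gap   : ∀ {g} → Inner (X p) (Y p) → GapOf (X p) (Y p) g → Label p (inj₂ (inj₂ g))

  labels : List ((ℕ ⊎ ℕ) ⊎ (ℕ ⊎ ℕ))
  labels = outerLabels ⊕ upTo (k ∸ 1) ⊕ upTo (l ∸ 2)

  length-labels : length labels ≡ k + (l ∸ 1) + ((k ∸ 1) + (l ∸ 2))
  length-labels = trans (length-⊕ outerLabels _) (cong₂ _+_ length-outerLabels
    (trans (length-⊕ (upTo (k ∸ 1)) _) (cong₂ _+_ (length-upTo (k ∸ 1)) (length-upTo (l ∸ 2)))))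

  label : ∀ {p} → p ∈ F → ∃ λ b → b ∈ labels × Label p b
  label {p} p∈ with Inner? (X p) (Y p)
  ... | no ¬inner with b , b∈ , o ← outer-label p∈ ¬inner = _ , ∈-⊕⁺ˡ b∈ , outer o
  ... | yes inner with anyUpTo? (λ t → (Y p <? t) ×-dec Inner? (X p) t) l
  ...   | no none = _ , ∈-⊕⁺ʳ {xs = outerLabels} (∈-⊕⁺ˡ (∈-upTo⁺ (Inner⇒X< inner)))
    , top inner λ y<t i → none (_ , At⇒Y< (proj₁ i) , y<t , i)
  ...   | yes (_ , _ , above) with least (λ t → (Y p <? t) ×-dec Inner? (X p) t) above
  ...     | t , (y<t , it) , _ , min with g , y≤g , g<t , unc ← uncovered-gap y<t inner it =
    _ , ∈-⊕⁺ʳ {xs = outerLabels} (∈-⊕⁺ʳ {xs = upTo (k ∸ 1)} (∈-upTo⁺ g<))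
    , gap inner (y≤g , (t , g<t , it , λ y<s s<t i → min s<t (y<s , i)) , unc)
    where
    -- The inner point at height `t` has a point above it, so g < t ≤ l - 2.
    g< : g < l ∸ 2
    g< = ≤-trans (∸-monoˡ-≤ 1 (≤-trans (s≤s g<t) (Inner⇒Y< it))) (≤-reflexive (∸-+-assoc l 1 1))

  -- The column of the labelled point straddles g and no column to its left does, so g determines
  -- the column. Within a column, the intervals between consecutive inner points share no gap.
  gap-injective : ∀ {x y x′ y′ g} → Inner x y → Inner x′ y′ → GapOf x y g → GapOf x′ y′ g → x ≡ x′ × y ≡ y′
  gap-injective {x} {y} {x′} {y′} i i′ (y≤g , (t , g<t , it , next) , unc) (y′≤g , (t′ , g<t′ , it′ , next′) , unc′)
    with <-cmp x x′
  ... | tri< x<x′ _ _ = ⊥-elim (unc′ x<x′ ((y , s≤s y≤g , i) , (t , At⇒Y< (proj₁ it) , g<t , it)))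
  ... | tri> _ _ x′<x = ⊥-elim (unc x′<x ((y′ , s≤s y′≤g , i′) , (t′ , At⇒Y< (proj₁ it′) , g<t′ , it′)))
  ... | tri≈ _ refl _ with <-cmp y y′
  ...   | tri< y<y′ _ _ = ⊥-elim (next y<y′ (≤-<-trans y′≤g g<t) i′)
  ...   | tri≈ _ eq _   = refl , eq
  ...   | tri> _ _ y′<y = ⊥-elim (next′ y′<y (≤-<-trans y≤g g<t′) i)

  label-injective : ∀ {p q b} → p ∈ F → q ∈ F → Label p b → Label q b → p ≡ q
  label-injective {p} {q} p∈ q∈ lp lq = go lp lq refl
    where
    go : ∀ {b c} → Label p b → Label q c → b ≡ c → p ≡ q
    go (outer o) (outer o′) refl = outer-injective p∈ q∈ o o′
    go (top i t) (top i′ t′) eq with inj₁-injective (inj₂-injective eq) | <-cmp (Y p) (Y q)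
    ... | eqx | tri< lt _ _ = ⊥-elim (t lt (subst (λ x → Inner x (Y q)) (sym eqx) i′))
    ... | eqx | tri≈ _ e _  = point-≡ eqx e
    ... | eqx | tri> _ _ gt = ⊥-elim (t′ gt (subst (λ x → Inner x (Y p)) eqx i))
    go (gap i γ) (gap i′ γ′) refl with eqx , eqy ← gap-injective i i′ γ γ′ = point-≡ eqx eqy
    go (outer _) (top _ _) ()
    go (outer _) (gap _ _) ()
    go (top _ _) (outer _) ()
    go (top _ _) (gap _ _) ()
    go (gap _ _) (outer _) ()
    go (gap _ _) (top _ _) ()

vee3-upper : ∀ {k l} → 2 ≤ k → 2 ≤ l → (F : List (Grid k l)) → Unique F → StrongFree (vee 3) F →
  length F ≤ 2 * (k + l) ∸ 4
vee3-upper {suc (suc k)} {suc (suc l)} (s≤s (s≤s _)) (s≤s (s≤s _)) F uniq free =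
  subst (length F ≤_) (trans length-labels arith) (length-≤-by-relation Label uniq label label-injective)
  where
  open Vee3Upper F free
  -- The counts of labels: columns, rows but the top one, columns but the last one (for topmost
  -- inner points), and gaps below an inner point.
  arith : suc (suc k) + suc l + (suc k + l) ≡ 2 * (suc (suc k) + suc (suc l)) ∸ 4
  arith = sym (trans (cong (_∸ 4) (expand k l)) (m+n∸n≡m _ 4))
    where
    expand : ∀ k l → 2 * (suc (suc k) + suc (suc l)) ≡ suc (suc k) + suc l + (suc k + l) + 4
    expand = solve-∀

-- Lower bounds for strong copies

exact : ∀ {k l Good m} {F : List (Grid k l)} → Unique F → Good F → m ≤ length F →
  (∀ F → Unique F → Good F → length F ≤ m) → IsMaxSize k l Good m
exact {F = F} uniq good m≤ upper = (F , uniq , good , ≤-antisym (upper F uniq good) m≤) , upper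

module Hook (k l : ℕ) where

  -- The left column followed by the top row, a maximal chain.
  OnHook : ℕ → ℕ → Set
  OnHook x y = x ≡ 0 ⊎ y ≡ l

  OnHook? : ∀ x y → Dec (OnHook x y)
  OnHook? x y = (x ≟ 0) ⊎-dec (y ≟ l)

  open Region (suc k) (suc l) OnHook?

  OnHook-chain : ∀ {k′} {p q : Grid k′ (suc l)} → OnHook (X p) (Y p) → OnHook (X q) (Y q) → p ≼ q ⊎ q ≼ p
  OnHook-chain {p = p} {q} (inj₁ a) (inj₁ b) with ≤-total (Y p) (Y q)
  ... | inj₁ h = inj₁ (≤-reflexive (trans a (sym b)) , h)
  ... | inj₂ h = inj₂ (≤-reflexive (trans b (sym a)) , h)
  OnHook-chain {p = p} {q} (inj₂ a) (inj₂ b) with ≤-total (X p) (X q)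
  ... | inj₁ h = inj₁ (h , ≤-reflexive (trans a (sym b)))
  ... | inj₂ h = inj₂ (h , ≤-reflexive (trans b (sym a)))
  OnHook-chain {p = p} {q} (inj₁ a) (inj₂ b) =
    inj₁ (≤-trans (≤-reflexive a) z≤n , ≤-trans (Finₚ.toℕ≤pred[n] (proj₂ p)) (≤-reflexive (sym b)))
  OnHook-chain {p = p} {q} (inj₂ a) (inj₁ b) =
    inj₂ (≤-trans (≤-reflexive b) z≤n , ≤-trans (Finₚ.toℕ≤pred[n] (proj₂ q)) (≤-reflexive (sym a)))

  hook : List (Grid (suc k) (suc l))
  hook = region

  hook-unique : Unique hook
  hook-unique = region-unique

  hook-chain : ∀ {p q} → p ∈ hook → q ∈ hook → p ≼ q ⊎ q ≼ p
  hook-chain p∈ q∈ = OnHook-chain (region⁻ p∈) (region⁻ q∈)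

  hook-size : suc k + l ≤ length hook
  hook-size = subst (_≤ length hook)
    (trans (length-⊕ (upTo (suc k)) (upTo l)) (cong₂ _+_ (length-upTo (suc k)) (length-upTo l)))
    (region-size (⊕-unique (Uniq.upTo⁺ (suc k)) (Uniq.upTo⁺ l)) pos inside inj)
    where
    pos : ℕ ⊎ ℕ → ℕ × ℕ
    pos (inj₁ x) = x , l
    pos (inj₂ y) = 0 , y

    y< : ∀ {y} → inj₂ y ∈ upTo (suc k) ⊕ upTo l → y < l
    y< b∈ = ∈-upTo⁻ (∈-⊕⁻ʳ {xs = upTo (suc k)} b∈)

    inside : ∀ {a} → a ∈ upTo (suc k) ⊕ upTo l →
      proj₁ (pos a) < suc k × proj₂ (pos a) < suc l × OnHook (proj₁ (pos a)) (proj₂ (pos a))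
    inside {inj₁ x} x∈ = ∈-upTo⁻ (∈-⊕⁻ˡ {ys = upTo l} x∈) , ≤-refl , inj₂ refl
    inside {inj₂ y} y∈ = s≤s z≤n , m<n⇒m<1+n (y< y∈) , inj₁ refl

    inj : ∀ {a b} → a ∈ upTo (suc k) ⊕ upTo l → b ∈ upTo (suc k) ⊕ upTo l → pos a ≡ pos b → a ≡ b
    inj {inj₁ _} {inj₁ _} _  _  refl = refl
    inj {inj₂ _} {inj₂ _} _  _  refl = refl
    inj {inj₁ _} {inj₂ _} _  b∈ refl = ⊥-elim (<-irrefl refl (y< b∈))
    inj {inj₂ _} {inj₁ _} a∈ _  refl = ⊥-elim (<-irrefl refl (y< a∈))

  hook-vee-free : StrongFree (vee 2) hook
  hook-vee-free = chains⇒vee-free (λ _ → 0) (λ _ → s≤s z≤n) (λ p∈ q∈ _ → hook-chain p∈ q∈)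

  hook-wedge-free : StrongFree wedge2 hook
  hook-wedge-free = chain⇒wedge-free hook-chain

La*-vee2 : ∀ k l → 1 ≤ k → 1 ≤ l → IsLaStar k l (vee 2) (k + l ∸ 1)
La*-vee2 (suc k) (suc l) _ 1≤l = exact hook-unique hook-vee-free
  (≤-trans (≤-reflexive (+-suc k l)) hook-size) (vee2-upper 1≤l)
  where open Hook k l

La*-vee2-wedge2 : ∀ k l → 1 ≤ k → 1 ≤ l → IsLaStar₂ k l (vee 2) wedge2 (k + l ∸ 1)
La*-vee2-wedge2 (suc k) (suc l) _ 1≤l = exact hook-unique (hook-vee-free , hook-wedge-free)
  (≤-trans (≤-reflexive (+-suc k l)) hook-size) (λ F uniq (free , _) → vee2-upper 1≤l F uniq free)
  where open Hook k l

-- The boundary of the grid is the union of two chains: the left column with the top row, and the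
-- bottom row with the right column.
module Boundary (k l : ℕ) where

  open Hook k l using (OnHook; OnHook?; OnHook-chain)

  OnHook′ : ℕ → ℕ → Set
  OnHook′ x y = y ≡ 0 ⊎ x ≡ k

  OnBoundary : ℕ → ℕ → Set
  OnBoundary x y = OnHook x y ⊎ OnHook′ x y

  OnBoundary? : ∀ x y → Dec (OnBoundary x y)
  OnBoundary? x y = OnHook? x y ⊎-dec ((y ≟ 0) ⊎-dec (x ≟ k))

  open Region (suc k) (suc l) OnBoundary?

  boundary : List (Grid (suc k) (suc l))
  boundary = region

  boundary-unique : Unique boundary
  boundary-unique = region-unique

  -- Reflection in the diagonal turns the bottom row and right column into a hook of the transposed
  -- grid.
  OnHook′-chain : ∀ {p q : Grid (suc k) (suc l)} → OnHook′ (X p) (Y p) → OnHook′ (X q) (Y q) → p ≼ q ⊎ q ≼ p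
  OnHook′-chain {p₁ , p₂} {q₁ , q₂} a b with Hook.OnHook-chain l k {p = p₂ , p₁} {q = q₂ , q₁} a b
  ... | inj₁ (u , v) = inj₁ (v , u)
  ... | inj₂ (u , v) = inj₂ (v , u)

  side : ∀ {A : Set} → Dec A → ℕ
  side (yes _) = 0
  side (no _)  = 1

  side<2 : ∀ {A : Set} (a? : Dec A) → side a? < 2
  side<2 (yes _) = s≤s z≤n
  side<2 (no _)  = s≤s (s≤s z≤n)

  same-side : ∀ {p q : Grid (suc k) (suc l)} (a? : Dec (OnHook (X p) (Y p))) (b? : Dec (OnHook (X q) (Y q))) →
    OnBoundary (X p) (Y p) → OnBoundary (X q) (Y q) → side a? ≡ side b? → p ≼ q ⊎ q ≼ p
  same-side (yes a) (yes b) _        _        _  = OnHook-chain a b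
  same-side (no ¬a) (no _)  (inj₁ a) _        _  = ⊥-elim (¬a a)
  same-side (no _)  (no ¬b) (inj₂ _) (inj₁ b) _  = ⊥-elim (¬b b)
  same-side (no _)  (no _)  (inj₂ a) (inj₂ b) _  = OnHook′-chain a b
  same-side (yes _) (no _)  _        _        ()
  same-side (no _)  (yes _) _        _        ()

  boundary-vee-free : StrongFree (vee 3) boundary
  boundary-vee-free = chains⇒vee-free (λ p → side (OnHook? (X p) (Y p)))
    (λ {p} _ → side<2 (OnHook? (X p) (Y p)))
    (λ {p} {q} p∈ q∈ → same-side (OnHook? (X p) (Y p)) (OnHook? (X q) (Y q)) (region⁻ p∈) (region⁻ q∈))

  sides : List ((ℕ ⊎ ℕ) ⊎ (ℕ ⊎ ℕ))
  sides = (upTo k ⊕ upTo l) ⊕ (upTo k ⊕ upTo l)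

  length-sides : length sides ≡ (k + l) + (k + l)
  length-sides = trans (length-⊕ (upTo k ⊕ upTo l) (upTo k ⊕ upTo l)) (cong₂ _+_ half half)
    where
    half : length (upTo k ⊕ upTo l) ≡ k + l
    half = trans (length-⊕ (upTo k) (upTo l)) (cong₂ _+_ (length-upTo k) (length-upTo l))

  boundary-size : 1 ≤ k → 1 ≤ l → (k + l) + (k + l) ≤ length boundary
  boundary-size 1≤k 1≤l = subst (_≤ length boundary) length-sides
    (region-size (⊕-unique half-unique half-unique) pos inside inj)
    where
    half-unique : Unique (upTo k ⊕ upTo l)
    half-unique = ⊕-unique (Uniq.upTo⁺ k) (Uniq.upTo⁺ l)

    -- Each side omits one of its ends, so that every corner is parametrized exactly once.
    pos : (ℕ ⊎ ℕ) ⊎ (ℕ ⊎ ℕ) → ℕ × ℕ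
    pos (inj₁ (inj₁ x)) = x , l
    pos (inj₁ (inj₂ y)) = 0 , y
    pos (inj₂ (inj₁ x)) = suc x , 0
    pos (inj₂ (inj₂ y)) = k , suc y

    x<ˡ : ∀ {x} → inj₁ (inj₁ x) ∈ sides → x < k
    x<ˡ a∈ = ∈-upTo⁻ (∈-⊕⁻ˡ {ys = upTo l} (∈-⊕⁻ˡ {ys = upTo k ⊕ upTo l} a∈))
    y<ˡ : ∀ {y} → inj₁ (inj₂ y) ∈ sides → y < l
    y<ˡ a∈ = ∈-upTo⁻ (∈-⊕⁻ʳ {xs = upTo k} (∈-⊕⁻ˡ {ys = upTo k ⊕ upTo l} a∈))
    x<ʳ : ∀ {x} → inj₂ (inj₁ x) ∈ sides → x < k
    x<ʳ a∈ = ∈-upTo⁻ (∈-⊕⁻ˡ {ys = upTo l} (∈-⊕⁻ʳ {xs = upTo k ⊕ upTo l} a∈))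
    y<ʳ : ∀ {y} → inj₂ (inj₂ y) ∈ sides → y < l
    y<ʳ a∈ = ∈-upTo⁻ (∈-⊕⁻ʳ {xs = upTo k} (∈-⊕⁻ʳ {xs = upTo k ⊕ upTo l} a∈))

    inside : ∀ {a} → a ∈ sides →
      proj₁ (pos a) < suc k × proj₂ (pos a) < suc l × OnBoundary (proj₁ (pos a)) (proj₂ (pos a))
    inside {inj₁ (inj₁ x)} a∈ = m<n⇒m<1+n (x<ˡ a∈) , ≤-refl , inj₁ (inj₂ refl)
    inside {inj₁ (inj₂ y)} a∈ = s≤s z≤n , m<n⇒m<1+n (y<ˡ a∈) , inj₁ (inj₁ refl)
    inside {inj₂ (inj₁ x)} a∈ = s≤s (x<ʳ a∈) , s≤s z≤n , inj₂ (inj₁ refl)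
    inside {inj₂ (inj₂ y)} a∈ = ≤-refl , s≤s (y<ʳ a∈) , inj₂ (inj₂ refl)

    inj : ∀ {a b} → a ∈ sides → b ∈ sides → pos a ≡ pos b → a ≡ b
    inj {inj₁ (inj₁ _)} {inj₁ (inj₁ _)} _  _  refl = refl
    inj {inj₁ (inj₂ _)} {inj₁ (inj₂ _)} _  _  refl = refl
    inj {inj₂ (inj₁ _)} {inj₂ (inj₁ _)} _  _  refl = refl
    inj {inj₂ (inj₂ _)} {inj₂ (inj₂ _)} _  _  refl = refl
    inj {inj₁ (inj₁ _)} {inj₁ (inj₂ _)} _  b∈ refl = ⊥-elim (<-irrefl refl (y<ˡ b∈))
    inj {inj₁ (inj₂ _)} {inj₁ (inj₁ _)} a∈ _  refl = ⊥-elim (<-irrefl refl (y<ˡ a∈))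
    inj {inj₁ (inj₁ _)} {inj₂ (inj₁ _)} _  _  refl = ⊥-elim (<-irrefl refl 1≤l)
    inj {inj₂ (inj₁ _)} {inj₁ (inj₁ _)} _  _  refl = ⊥-elim (<-irrefl refl 1≤l)
    inj {inj₁ (inj₁ _)} {inj₂ (inj₂ _)} a∈ _  refl = ⊥-elim (<-irrefl refl (x<ˡ a∈))
    inj {inj₂ (inj₂ _)} {inj₁ (inj₁ _)} _  b∈ refl = ⊥-elim (<-irrefl refl (x<ˡ b∈))
    inj {inj₁ (inj₂ _)} {inj₂ (inj₁ _)} _  _  ()
    inj {inj₂ (inj₁ _)} {inj₁ (inj₂ _)} _  _  ()
    inj {inj₁ (inj₂ _)} {inj₂ (inj₂ _)} _  _  refl = ⊥-elim (<-irrefl refl 1≤k)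
    inj {inj₂ (inj₂ _)} {inj₁ (inj₂ _)} _  _  refl = ⊥-elim (<-irrefl refl 1≤k)
    inj {inj₂ (inj₁ _)} {inj₂ (inj₂ _)} _  _  ()
    inj {inj₂ (inj₂ _)} {inj₂ (inj₁ _)} _  _  ()

La*-vee3 : ∀ k l → 2 ≤ k → 2 ≤ l → IsLaStar k l (vee 3) (2 * (k + l) ∸ 4)
La*-vee3 (suc k) (suc l) 2≤k 2≤l = exact boundary-unique boundary-vee-free
  (≤-trans (≤-reflexive (trans (cong (_∸ 4) (expand k l)) (m+n∸n≡m _ 4)))
    (boundary-size (≤-pred 2≤k) (≤-pred 2≤l)))
  (vee3-upper 2≤k 2≤l)
  where
  open Boundary k l
  expand : ∀ k l → 2 * (suc k + suc l) ≡ (k + l) + (k + l) + 4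
  expand = solve-∀

module Band (k t : ℕ) where

  InBand : ℕ → ℕ → Set
  InBand x y = y ≤ x × x < y + 2 * t

  InBand? : ∀ x y → Dec (InBand x y)
  InBand? x y = (y ≤? x) ×-dec (x <? y + 2 * t)

  open Region k k InBand?

  band : List (Grid k k)
  band = region

  band-unique : Unique band
  band-unique = region-unique

  -- Two consecutive diagonals x - y = 2i and x - y = 2i + 1 together form one chain, so 2t
  -- diagonals need only t colours.
  colour : Grid k k → ℕ
  colour p = (X p ∸ Y p) /ℕ 2

  colour< : ∀ {p} → p ∈ band → colour p < t
  colour< {p} p∈ with y≤x , x< ← region⁻ p∈ = m<n*o⇒m/o<n
    (subst (X p ∸ Y p <_) (*-comm 2 t) (+-cancelˡ-< (Y p) _ _ (subst (_< Y p + 2 * t) (sym (m+[n∸m]≡n y≤x)) x<)))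

  half-≡⇒≤ : ∀ {a b} → a /ℕ 2 ≡ b /ℕ 2 → b ≤ suc a
  half-≡⇒≤ {a} {b} eq = begin
    b                  ≡⟨ m≡m%n+[m/n]*n b 2 ⟩
    b % 2 + b /ℕ 2 * 2  ≤⟨ +-monoˡ-≤ (b /ℕ 2 * 2) (≤-pred (m%n<n b 2)) ⟩
    suc (b /ℕ 2 * 2)    ≡⟨ cong (λ h → suc (h * 2)) (sym eq) ⟩
    suc (a /ℕ 2 * 2)    ≤⟨ s≤s (m/n*n≤m a 2) ⟩
    suc a              ∎
    where open ≤-Reasoning

  -- If y dropped while x grew, x - y would increase by at least 2 and its half would change.
  ordered : ∀ {x y x′ y′} → y ≤ x → y′ ≤ x′ → (x ∸ y) /ℕ 2 ≡ (x′ ∸ y′) /ℕ 2 → x < x′ → y ≤ y′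
  ordered {x} {y} {x′} {y′} y≤x y′≤x′ eq x<x′ = ≮⇒≥ λ y′<y → <-irrefl refl (begin-strict
    x                       <⟨ x<x′ ⟩
    x′                      ≡⟨ sym (m+[n∸m]≡n y′≤x′) ⟩
    y′ + (x′ ∸ y′)          ≤⟨ +-monoʳ-≤ y′ (half-≡⇒≤ {x ∸ y} {x′ ∸ y′} eq) ⟩
    y′ + suc (x ∸ y)        ≡⟨ +-suc y′ (x ∸ y) ⟩
    suc y′ + (x ∸ y)        ≤⟨ +-monoˡ-≤ (x ∸ y) y′<y ⟩
    y + (x ∸ y)             ≡⟨ m+[n∸m]≡n y≤x ⟩
    x                       ∎)
    where open ≤-Reasoning

  colour-chain : ∀ {p q} → p ∈ band → q ∈ band → colour p ≡ colour q → p ≼ q ⊎ q ≼ p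
  colour-chain {p} {q} p∈ q∈ eq with y≤x , _ ← region⁻ p∈ | y′≤x′ , _ ← region⁻ q∈ | <-cmp (X p) (X q)
  ... | tri< lt _ _ = inj₁ (<⇒≤ lt , ordered y≤x y′≤x′ eq lt)
  ... | tri> _ _ gt = inj₂ (<⇒≤ gt , ordered y′≤x′ y≤x (sym eq) gt)
  ... | tri≈ _ e _ with ≤-total (Y p) (Y q)
  ...   | inj₁ h = inj₁ (≤-reflexive e , h)
  ...   | inj₂ h = inj₂ (≤-reflexive (sym e) , h)

  band-vee-free : StrongFree (vee (suc t)) band
  band-vee-free = chains⇒vee-free colour colour< colour-chain

  -- Each of the lowest k - 2t rows contains 2t points of the band.
  band-size : 2 * t * (k ∸ 2 * t) ≤ length band
  band-size = subst (_≤ length band)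
    (trans (length-cartesianProduct (upTo n) (upTo (k ∸ n))) (cong₂ _*_ (length-upTo n) (length-upTo (k ∸ n))))
    (region-size (Uniq.cartesianProduct⁺ (Uniq.upTo⁺ n) (Uniq.upTo⁺ (k ∸ n))) pos inside
      (λ {a} {b} _ _ → pos-injective {a} {b}))
    where
    n = 2 * t
    pos : ℕ × ℕ → ℕ × ℕ
    pos (j , y) = y + j , y
    inside : ∀ {a} → a ∈ cartesianProduct (upTo n) (upTo (k ∸ n)) →
      proj₁ (pos a) < k × proj₂ (pos a) < k × InBand (proj₁ (pos a)) (proj₂ (pos a))
    inside {j , y} a∈ with j∈ , y∈ ← ∈-cartesianProduct⁻ (upTo n) (upTo (k ∸ n)) a∈ =
      x<k , ≤-<-trans (m≤m+n y j) x<k , m≤m+n y j , +-monoʳ-< y (∈-upTo⁻ j∈)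
      where
      x<k : y + j < k
      x<k = <-trans (+-monoʳ-< y (∈-upTo⁻ j∈)) (subst (_< k) (+-comm n y) (m<n∸o⇒o+m<n k n (∈-upTo⁻ y∈)))
    pos-injective : ∀ {a b} → pos a ≡ pos b → a ≡ b
    pos-injective {j , y} {j′ , y′} eq with refl ← cong proj₂ eq = cong (_, y) (+-cancelˡ-≡ y j j′ (cong proj₁ eq))

La*-vee-lower : ∃ λ C → ∀ s → 1 ≤ s → ∀ k m → IsLaStar k k (vee s) m → 2 * (s ∸ 1) * k ≤ m + C * (s * s)
-- The 2t rows left out by `band-size`, where t = s - 1, cost (2t)² ≤ 4s² points.
La*-vee-lower = 4 , bound
  where
  open ≤-Reasoning
  bound : ∀ s → 1 ≤ s → ∀ k m → IsLaStar k k (vee s) m → 2 * (s ∸ 1) * k ≤ m + 4 * (s * s)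
  bound (suc t) _ k m (_ , upper) = begin
    n * k                          ≤⟨ *-monoʳ-≤ n (m≤n+m∸n k n) ⟩
    n * (n + (k ∸ n))              ≡⟨ *-distribˡ-+ n n (k ∸ n) ⟩
    n * n + n * (k ∸ n)            ≤⟨ +-monoʳ-≤ (n * n) (≤-trans band-size (upper band band-unique band-vee-free)) ⟩
    n * n + m                      ≡⟨ +-comm (n * n) m ⟩
    m + n * n                      ≡⟨ cong (λ a → m + a) (square t) ⟩
    m + 4 * (t * t)                ≤⟨ +-monoʳ-≤ m (*-monoʳ-≤ 4 (*-mono-≤ (n≤1+n t) (n≤1+n t))) ⟩
    m + 4 * (suc t * suc t)        ∎
    where
    open Band k t
    n = 2 * t
    square : ∀ t → 2 * t * (2 * t) ≡ 4 * (t * t)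
    square = solve-∀

-- Weak copies of ∨_s: upper bound

row : ℕ → List (ℕ × ℕ)
row t = map (t ,_) (upTo t)

-- The pairs (t, r) with r < t ≤ d. They index residues modulo t in the upper bound and positions on
-- antidiagonals in the lower bound.
triangle : ℕ → List (ℕ × ℕ)
triangle zero    = []
triangle (suc d) = row (suc d) ++ triangle d

length-row : ∀ t → length (row t) ≡ t
length-row t = trans (length-map _ (upTo t)) (length-upTo t)

-- The sum `S` starts at 2; the outer successor restores the summand 1.
length-triangle : ∀ d → length (triangle (suc d)) ≡ suc (S (suc d))
length-triangle zero    = refl
length-triangle (suc d) = trans (length-++ (row (suc (suc d))) {triangle (suc d)})
  (trans (cong₂ _+_ (length-row (suc (suc d))) (length-triangle d)) (+-comm (suc (suc d)) (suc (S (suc d)))))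

∈-triangle⁺ : ∀ {d t r} → r < t → t ≤ d → (t , r) ∈ triangle d
∈-triangle⁺ {zero}  r<t z≤n = ⊥-elim (<⇒≱ r<t z≤n)
∈-triangle⁺ {suc d} r<t t≤ with m≤n⇒m<n∨m≡n t≤
... | inj₁ t<   = ∈-++⁺ʳ (row (suc d)) (∈-triangle⁺ r<t (≤-pred t<))
... | inj₂ refl = ∈-++⁺ˡ (∈-map⁺ (suc d ,_) (∈-upTo⁺ r<t))

%-≡⇒+≤ : ∀ {a b} n → a < b → a % suc n ≡ b % suc n → a + suc n ≤ b
%-≡⇒+≤ {a} {b} n a<b eq = begin
  a + N                      ≡⟨ cong (_+ N) (m≡m%n+[m/n]*n a N) ⟩
  a % N + a /ℕ N * N + N      ≡⟨ +-assoc (a % N) (a /ℕ N * N) N ⟩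
  a % N + (a /ℕ N * N + N)    ≡⟨ cong₂ _+_ eq (+-comm (a /ℕ N * N) N) ⟩
  b % N + suc (a /ℕ N) * N    ≤⟨ +-monoʳ-≤ (b % N) (*-monoˡ-≤ N quotients) ⟩
  b % N + b /ℕ N * N          ≡⟨ sym (m≡m%n+[m/n]*n b N) ⟩
  b                          ∎
  where
  open ≤-Reasoning
  N = suc n
  quotients : a /ℕ N < b /ℕ N
  quotients = ≰⇒> λ b/N≤a/N → <⇒≱ a<b (begin
    b                  ≡⟨ m≡m%n+[m/n]*n b N ⟩
    b % N + b /ℕ N * N  ≤⟨ +-mono-≤ (≤-reflexive (sym eq)) (*-monoˡ-≤ N b/N≤a/N) ⟩
    a % N + a /ℕ N * N  ≡⟨ sym (m≡m%n+[m/n]*n a N) ⟩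
    a                  ∎)

module WeakUpper {k l s : ℕ} (F : List (Grid k l)) (uniq : Unique F) (free : WeakFree (vee s) F) where

  above? : ∀ (p q : Grid k l) → Dec (p ≼ q × p ≢ q)
  above? p q = (p ≼? q) ×-dec ¬? (p ≟ᴳ q)

  above : Grid k l → List (Grid k l)
  above p = filter (above? p) F

  -- Any s points above p yield a weak copy with root p, since a weak copy puts no condition on the
  -- relations among its leaves.
  length-above : ∀ {p} → p ∈ F → suc (length (above p)) ≤ s
  length-above {p} p∈ = ≰⇒> λ s≤ → free (f s≤ , (λ {i} {j} → f-injective s≤ {i} {j}) , f∈ s≤ , f-mono s≤)
    where
    module _ (s≤ : s ≤ length (above p)) where
      f : Fin (suc s) → Grid k l
      f fzero    = p
      f (fsuc i) = lookup (above p) (inject≤ i s≤)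

      f-above : ∀ i → f (fsuc i) ∈ F × p ≼ f (fsuc i) × p ≢ f (fsuc i)
      f-above i = ∈-filter⁻ (above? p) {xs = F} (∈-lookup (inject≤ i s≤))

      f∈ : ∀ i → f i ∈ F
      f∈ fzero    = p∈
      f∈ (fsuc i) = proj₁ (f-above i)

      f-injective : Injective _≡_ _≡_ f
      f-injective {fzero}  {fzero}  _  = refl
      f-injective {fzero}  {fsuc j} eq = ⊥-elim (proj₂ (proj₂ (f-above j)) eq)
      f-injective {fsuc i} {fzero}  eq = ⊥-elim (proj₂ (proj₂ (f-above i)) (sym eq))
      f-injective {fsuc i} {fsuc j} eq = cong fsuc
        (Finₚ.inject≤-injective s≤ s≤ i j (lookup-injective (Uniq.filter⁺ (above? p) uniq) eq))

      f-mono : ∀ i j → vee s i j → f i ≼ f j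
      f-mono i      .i       (inj₁ refl) = ≤-refl , ≤-refl
      f-mono .fzero fzero    (inj₂ refl) = ≤-refl , ≤-refl
      f-mono .fzero (fsuc j) (inj₂ refl) = proj₁ (proj₂ (f-above j))

  -- Everything that dominates, from column c onwards, a point in columns ≤ c also dominates the
  -- lowest point in columns ≤ c.
  column : ∀ c → ∃ λ U → length U ≤ s ×
    (∀ {p q} → p ∈ F → q ∈ F → X p ≤ c → c ≤ X q → Y p ≤ Y q → q ∈ U)
  column c with anyUpTo? occupied? l
    where
    occupied? : Decidable λ y → ∃ λ x → x < suc c × At F x y
    occupied? y = anyUpTo? (λ x → At? F x y) (suc c)
  ... | no none = [] , z≤n , λ p∈ _ x≤c _ _ → ⊥-elim (none (_ , At⇒Y< (at p∈) , _ , s≤s x≤c , at p∈))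
  ... | yes (_ , _ , occ) with least (λ y → anyUpTo? (λ x → At? F x y) (suc c)) occ
  ...   | y , (x , x≤c , p₀ , p₀∈ , refl , refl) , _ , min = p₀ ∷ above p₀ , length-above p₀∈ , covers
    where
    covers : ∀ {p q} → p ∈ F → q ∈ F → X p ≤ c → c ≤ X q → Y p ≤ Y q → q ∈ p₀ ∷ above p₀
    covers {p} {q} p∈ q∈ xp≤c c≤xq yp≤yq with p₀ ≟ᴳ q
    ... | yes refl = here refl
    ... | no p₀≢q = there (∈-filter⁺ (above? p₀) q∈
      ((≤-trans (≤-pred x≤c) c≤xq , ≤-trans (≮⇒≥ λ lt → min lt (_ , s≤s xp≤c , at p∈)) yp≤yq) , p₀≢q))

  columns : ℕ → List (ℕ × Grid k l)
  columns zero    = []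
  columns (suc c) = map (c ,_) (proj₁ (column c)) ++ columns c

  length-columns : ∀ n → length (columns n) ≤ n * s
  length-columns zero    = z≤n
  length-columns (suc c) = ≤-trans (≤-reflexive (length-++ (map (c ,_) (proj₁ (column c)))))
    (+-mono-≤ (≤-trans (≤-reflexive (length-map (c ,_) (proj₁ (column c)))) (proj₁ (proj₂ (column c))))
      (length-columns c))

  ∈-columns⁺ : ∀ {n c q} → c < n → q ∈ proj₁ (column c) → (c , q) ∈ columns n
  ∈-columns⁺ {suc n} c≤n q∈ with m≤n⇒m<n∨m≡n (≤-pred c≤n)
  ... | inj₁ c<n  = ∈-++⁺ʳ (map (n ,_) (proj₁ (column n))) (∈-columns⁺ c<n q∈)
  ... | inj₂ refl = ∈-++⁺ˡ (∈-map⁺ (n ,_) q∈)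

  module _ (d : ℕ) where

    -- Here t runs from 0 to d + 1: the d of the overview is `suc d` in this module.
    pairs : List (ℕ × Grid k l)
    pairs = cartesianProduct (upTo (suc (suc d))) F

    labels : List ((ℕ × Grid k l) ⊎ ((ℕ × ℕ) × ℕ))
    labels = columns k ⊕ cartesianProduct (triangle (suc d)) (upTo l)

    length-labels : length labels ≤ k * s + suc (S (suc d)) * l
    length-labels = ≤-trans (≤-reflexive (length-⊕ (columns k) _)) (+-mono-≤ (length-columns k)
      (≤-reflexive (trans (length-cartesianProduct (triangle (suc d)) (upTo l))
        (cong₂ _*_ (length-triangle d) (length-upTo l)))))

    -- The additive form treats t > X q correctly: no column lies that far to the left, and q is
    -- isolated.
    Isolated : ℕ → Grid k l → Set
    Isolated t q = ∀ {p} → p ∈ F → X p + t ≤ X q → ¬ (Y p ≤ Y q)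

    data Label : ℕ × Grid k l → (ℕ × Grid k l) ⊎ ((ℕ × ℕ) × ℕ) → Set where
      dominated : ∀ {t q c} → c + t ≡ X q → Label (t , q) (inj₁ (c , q))
      isolated  : ∀ {t q} → Isolated (suc t) q → Label (suc t , q) (inj₂ ((suc t , X q % suc t) , Y q))

    label : ∀ {a} → a ∈ pairs → ∃ λ b → b ∈ labels × Label a b
    label {t , q} a∈ with t∈ , q∈ ← ∈-cartesianProduct⁻ (upTo (suc (suc d))) F a∈
      with any? (λ p → (X p + t ≤? X q) ×-dec (Y p ≤? Y q)) F
    ... | yes some with p , p∈ , x≤ , y≤ ← find some =
      _ , ∈-⊕⁺ˡ (∈-columns⁺ (≤-<-trans (m∸n≤m (X q) t) (At⇒X< (at q∈)))
        (proj₂ (proj₂ (column (X q ∸ t))) p∈ q∈ (m+n≤o⇒m≤o∸n (X p) x≤) (m∸n≤m (X q) t) y≤))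
      , dominated (m∸n+n≡m (m+n≤o⇒n≤o (X p) x≤))
    -- For t = 0 the point q is its own witness, so residues are taken only modulo t ≥ 1.
    label {zero , q}  a∈ | no none = ⊥-elim (none (lose q∈ (≤-reflexive (+-identityʳ (X q)) , ≤-refl)))
    label {suc t , q} a∈ | no none =
      _ , ∈-⊕⁺ʳ {xs = columns k} (∈-cartesianProduct⁺ (∈-triangle⁺ (m%n<n (X q) (suc t)) (≤-pred (∈-upTo⁻ t∈)))
        (∈-upTo⁺ (At⇒Y< (at q∈))))
      , isolated λ p∈ x≤ y≤ → none (lose p∈ (x≤ , y≤))

    -- Of two congruent points in one row, the left one is at least t + 1 columns away and at the
    -- same height, which contradicts the isolation of the right one.
    isolated-injective : ∀ {t q q′} → q ∈ F → q′ ∈ F → Isolated (suc t) q → Isolated (suc t) q′ →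
      X q % suc t ≡ X q′ % suc t → Y q ≡ Y q′ → q ≡ q′
    isolated-injective {t} {q} {q′} q∈ q′∈ iso iso′ eq% eqy with <-cmp (X q) (X q′)
    ... | tri< lt _ _ = ⊥-elim (iso′ q∈ (%-≡⇒+≤ t lt eq%) (≤-reflexive eqy))
    ... | tri≈ _ e _  = point-≡ e eqy
    ... | tri> _ _ gt = ⊥-elim (iso q′∈ (%-≡⇒+≤ t gt (sym eq%)) (≤-reflexive (sym eqy)))

    label-injective : ∀ {a a′ b} → a ∈ pairs → a′ ∈ pairs → Label a b → Label a′ b → a ≡ a′
    label-injective a∈ a′∈ la la′ = go a∈ a′∈ la la′ refl
      where
      go : ∀ {a a′ b b′} → a ∈ pairs → a′ ∈ pairs → Label a b → Label a′ b′ → b ≡ b′ → a ≡ a′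
      go _ _ (dominated {t} {q} {c} eq) (dominated {t′} eq′) refl =
        cong (_, q) (+-cancelˡ-≡ c t t′ (trans eq (sym eq′)))
      go a∈ a′∈ (isolated {t} {q} iso) (isolated {t′} {q′} iso′) eq
        with refl ← cong (λ { (inj₁ _) → 0 ; (inj₂ ((a , _) , _)) → a }) eq = cong (suc t ,_)
          (isolated-injective (proj₂ (∈-cartesianProduct⁻ (upTo (suc (suc d))) F a∈))
            (proj₂ (∈-cartesianProduct⁻ (upTo (suc (suc d))) F a′∈)) iso iso′
            (cong (λ { (inj₁ _) → 0 ; (inj₂ ((_ , r) , _)) → r }) eq)
            (cong (λ { (inj₁ _) → 0 ; (inj₂ (_ , y)) → y }) eq))
      go _ _ (dominated _) (isolated _) ()
      go _ _ (isolated _) (dominated _) ()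

    weak-upper : suc (suc d) * length F ≤ k * s + suc (S (suc d)) * l
    weak-upper = ≤-trans
      (≤-reflexive (sym (trans (length-cartesianProduct (upTo (suc (suc d))) F)
        (cong (_* length F) (length-upTo (suc (suc d)))))))
      (≤-trans (length-≤-by-relation Label (Uniq.cartesianProduct⁺ (Uniq.upTo⁺ (suc (suc d))) uniq)
        label label-injective) length-labels)

-- Weak copies of ∨_s: lower bound

-- On the square of side n + 1: the antidiagonals x + y = n, …, n + d, and those points of the next
-- one whose x lies in c fixed residue classes modulo d + 2.
module Staircase (n d c : ℕ) (c≤ : c ≤ suc (suc d)) where

  D : ℕ
  D = suc d

  InStair : ℕ → ℕ → Set
  InStair x y = (n ≤ x + y × x + y < n + D) ⊎ (x + y ≡ n + D × x % suc D < c)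

  InStair? : ∀ x y → Dec (InStair x y)
  InStair? x y = ((n ≤? x + y) ×-dec (x + y <? n + D)) ⊎-dec ((x + y ≟ n + D) ×-dec (x % suc D <? c))

  open Region (suc n) (suc n) InStair?

  stair : List (Grid (suc n) (suc n))
  stair = region

  stair-unique : Unique stair
  stair-unique = region-unique

  InStair⇒≥ : ∀ {x y} → InStair x y → n ≤ x + y
  InStair⇒≥ (inj₁ (n≤ , _)) = n≤
  InStair⇒≥ (inj₂ (eq , _)) = ≤-trans (m≤m+n n D) (≤-reflexive (sym eq))

  -- Count the points of the copy, root p included. On x + y = n + u their columns lie among the u +
  -- 1 values from X p to X p + u, which gives 1 + ... + D points for u < D. For u = D these are D +
  -- 1 consecutive columns, of which c have an allowed residue. This is one point too few.
  stair-vee-free : WeakFree (vee (suc (S D) + c)) stair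
  stair-vee-free (f , f-inj , f∈ , f-mono) = 1+n≰n
    (≤-trans (≤-reflexive (sym (length-tabulate f))) (≤-trans
      (length-≤-by-relation Label (Uniq.tabulate⁺ f-inj) label λ {_} {_} {b} → label-injective b)
      (≤-reflexive (trans (length-⊕ (triangle D) (upTo c)) (cong₂ _+_ (length-triangle d) (length-upTo c))))))
    where
    p : Grid (suc n) (suc n)
    p = f fzero

    labels : List ((ℕ × ℕ) ⊎ ℕ)
    labels = triangle D ⊕ upTo c

    Label : Grid (suc n) (suc n) → (ℕ × ℕ) ⊎ ℕ → Set
    -- The level is shifted by one: on x + y = n + (u - 1) the offset t takes u values, as in
    -- `triangle`.
    Label q (inj₁ (u , t)) = X p + t ≡ X q × n + u ≡ suc (X q + Y q)
    Label q (inj₂ r)       = X q % suc D ≡ r × X q + Y q ≡ n + D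

    p-above : ∀ {q} → q ∈ tabulate f → p ≼ q
    p-above q∈ with i , refl ← ∈-tabulate⁻ {f = f} q∈ = f-mono fzero i (inj₂ refl)

    -- Since p lies on or above x + y = n and Y p ≤ Y q, at most u remains for X q - X p.
    offset : ∀ {q u} → q ∈ tabulate f → X q + Y q ≡ n + u → X q ≤ X p + u
    offset {q} {u} q∈ eq = +-cancelʳ-≤ (Y p) (X q) (X p + u) (begin
      X q + Y p          ≤⟨ +-monoʳ-≤ (X q) (proj₂ (p-above q∈)) ⟩
      X q + Y q          ≡⟨ eq ⟩
      n + u              ≤⟨ +-monoˡ-≤ u (InStair⇒≥ {X p} {Y p} (region⁻ (f∈ fzero))) ⟩
      X p + Y p + u      ≡⟨ rearrange (X p) (Y p) u ⟩
      X p + u + Y p      ∎)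
      where
      open ≤-Reasoning
      rearrange : ∀ a b c → a + b + c ≡ a + c + b
      rearrange = solve-∀

    label : ∀ {q} → q ∈ tabulate f → ∃ λ b → b ∈ labels × Label q b
    label {q} q∈ with i , refl ← ∈-tabulate⁻ {f = f} q∈ with region⁻ (f∈ i)
    ... | inj₂ (eq , r<c) = inj₂ _ , ∈-⊕⁺ʳ {xs = triangle D} (∈-upTo⁺ r<c) , refl , eq
    ... | inj₁ (n≤ , <n+D) = inj₁ (suc u , t)
      , ∈-⊕⁺ˡ (∈-triangle⁺ (s≤s t≤u) u<D) , m+[n∸m]≡n xp≤xq
      , trans (+-suc n u) (cong suc n+u≡)
      where
      xp≤xq = proj₁ (p-above q∈)
      u = X (f i) + Y (f i) ∸ n
      t = X (f i) ∸ X p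
      n+u≡ : n + u ≡ X (f i) + Y (f i)
      n+u≡ = m+[n∸m]≡n n≤
      u<D : u < D
      u<D = +-cancelˡ-< n u D (subst (_< n + D) (sym n+u≡) <n+D)
      t≤u : t ≤ u
      t≤u = m≤n+o⇒m∸n≤o (X (f i)) (X p) (offset q∈ (sym n+u≡))

    -- Congruent columns are at least D + 1 apart, but `offset` confines them to a window of D + 1
    -- values.
    residue-≮ : ∀ {q q′} → q ∈ tabulate f → q′ ∈ tabulate f → X q % suc D ≡ X q′ % suc D →
      X q′ + Y q′ ≡ n + D → ¬ (X q < X q′)
    residue-≮ {q} {q′} q∈ q′∈ eq% eq lt = 1+n≰n (begin
      suc (X p + D)  ≡⟨ sym (+-suc (X p) D) ⟩
      X p + suc D    ≤⟨ +-monoˡ-≤ (suc D) (proj₁ (p-above q∈)) ⟩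
      X q + suc D    ≤⟨ %-≡⇒+≤ D lt eq% ⟩
      X q′           ≤⟨ offset q′∈ eq ⟩
      X p + D        ∎)
      where open ≤-Reasoning

    label-injective : ∀ {q q′} b → q ∈ tabulate f → q′ ∈ tabulate f → Label q b → Label q′ b → q ≡ q′
    label-injective {q} {q′} (inj₁ (u , t)) _ _ (x , s) (x′ , s′) = point-≡ eqx
      (+-cancelˡ-≡ (X q) _ _ (trans (suc-injective (trans (sym s) s′)) (cong (_+ Y q′) (sym eqx))))
      where
      eqx : X q ≡ X q′
      eqx = trans (sym x) x′
    label-injective {q} {q′} (inj₂ r) q∈ q′∈ (x , s) (x′ , s′) with <-cmp (X q) (X q′)
    ... | tri< lt _ _ = ⊥-elim (residue-≮ q∈ q′∈ (trans x (sym x′)) s′ lt)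
    ... | tri> _ _ gt = ⊥-elim (residue-≮ q′∈ q∈ (trans x′ (sym x)) s gt)
    ... | tri≈ _ e _  = point-≡ e (+-cancelˡ-≡ (X q) _ _ (trans s (trans (sym s′) (cong (_+ Y q′) (sym e)))))

  -- Complete periods of length D + 1 among the columns, without the first: there x could be below
  -- D, and the antidiagonal x + y = n + D would leave the square.
  blocks : ℕ
  blocks = suc n /ℕ suc D ∸ 1

  stair-size : (suc n ∸ D) * D + blocks * c ≤ length stair
  stair-size = subst (_≤ length stair)
    (trans (length-⊕ full sparse) (cong₂ _+_
      (trans (length-cartesianProduct (upTo (suc n ∸ D)) (upTo D)) (cong₂ _*_ (length-upTo (suc n ∸ D)) (length-upTo D)))
      (trans (length-cartesianProduct (upTo blocks) (upTo c)) (cong₂ _*_ (length-upTo blocks) (length-upTo c)))))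
    (region-size (⊕-unique (Uniq.cartesianProduct⁺ (Uniq.upTo⁺ (suc n ∸ D)) (Uniq.upTo⁺ D))
      (Uniq.cartesianProduct⁺ (Uniq.upTo⁺ blocks) (Uniq.upTo⁺ c))) pos inside inj)
    where
    open ≤-Reasoning
    full sparse : List (ℕ × ℕ)
    full   = cartesianProduct (upTo (suc n ∸ D)) (upTo D)
    sparse = cartesianProduct (upTo blocks) (upTo c)

    pos : (ℕ × ℕ) ⊎ (ℕ × ℕ) → ℕ × ℕ
    -- Columns start at D so that y = n + u - x stays at most n for every u < D.
    pos (inj₁ (i , u)) = D + i , u + (n ∸ (D + i))
    pos (inj₂ (j , r)) = r + suc j * suc D , D + (n ∸ (r + suc j * suc D))

    level : ∀ {x} u → x ≤ n → x + (u + (n ∸ x)) ≡ n + u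
    level {x} u x≤n = trans (rearrange x u (n ∸ x)) (cong (_+ u) (m+[n∸m]≡n x≤n))
      where
      rearrange : ∀ x u v → x + (u + v) ≡ x + v + u
      rearrange = solve-∀

    height : ∀ {x} u → u ≤ x → x ≤ n → u + (n ∸ x) < suc n
    height {x} u u≤x x≤n = s≤s (≤-trans (+-monoˡ-≤ (n ∸ x) u≤x) (≤-reflexive (m+[n∸m]≡n x≤n)))

    module Full {i u} (a∈ : inj₁ (i , u) ∈ full ⊕ sparse) where
      i<×u< = ∈-cartesianProduct⁻ (upTo (suc n ∸ D)) (upTo D) (∈-⊕⁻ˡ {ys = sparse} a∈)
      u<D : u < D
      u<D = ∈-upTo⁻ (proj₂ i<×u<)
      x≤n : D + i ≤ n
      x≤n = ≤-pred (m<n∸o⇒o+m<n (suc n) D (∈-upTo⁻ (proj₁ i<×u<)))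
      sum : proj₁ (pos (inj₁ (i , u))) + proj₂ (pos (inj₁ (i , u))) ≡ n + u
      sum = level u x≤n

    module Sparse {j r} (a∈ : inj₂ (j , r) ∈ full ⊕ sparse) where
      j<×r< = ∈-cartesianProduct⁻ (upTo blocks) (upTo c) (∈-⊕⁻ʳ {xs = full} a∈)
      r<c : r < c
      r<c = ∈-upTo⁻ (proj₂ j<×r<)
      x = r + suc j * suc D
      x≤n : x ≤ n
      x≤n = ≤-pred (begin-strict
        r + suc j * suc D      <⟨ +-monoˡ-< (suc j * suc D) (<-≤-trans r<c c≤) ⟩
        suc (suc j) * suc D    ≤⟨ *-monoˡ-≤ (suc D) (m<n∸o⇒o+m<n (suc n /ℕ suc D) 1 (∈-upTo⁻ (proj₁ j<×r<))) ⟩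
        suc n /ℕ suc D * suc D  ≤⟨ m/n*n≤m (suc n) (suc D) ⟩
        suc n                  ∎)
      residue : x % suc D ≡ r
      residue = trans ([m+kn]%n≡m%n r (suc j) (suc D)) (m<n⇒m%n≡m (<-≤-trans r<c c≤))
      D≤x : D ≤ x
      D≤x = ≤-trans (≤-trans (n≤1+n D) (m≤m+n (suc D) (j * suc D))) (m≤n+m (suc j * suc D) r)
      sum : x + (D + (n ∸ x)) ≡ n + D
      sum = level D x≤n

    inside : ∀ {a} → a ∈ full ⊕ sparse →
      proj₁ (pos a) < suc n × proj₂ (pos a) < suc n × InStair (proj₁ (pos a)) (proj₂ (pos a))
    inside {inj₁ (i , u)} a∈ = s≤s x≤n , height u (≤-trans (<⇒≤ u<D) (m≤m+n D i)) x≤n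
      , inj₁ (≤-trans (m≤m+n n u) (≤-reflexive (sym sum)) , subst (_< n + D) (sym sum) (+-monoʳ-< n u<D))
      where open Full a∈
    inside {inj₂ (j , r)} a∈ = s≤s x≤n , height D D≤x x≤n , inj₂ (sum , subst (_< c) (sym residue) r<c)
      where open Sparse a∈

    inj : ∀ {a b} → a ∈ full ⊕ sparse → b ∈ full ⊕ sparse → pos a ≡ pos b → a ≡ b
    inj {inj₁ (i , u)} {inj₁ (i′ , u′)} a∈ b∈ eq with refl ← +-cancelˡ-≡ D i i′ (cong proj₁ eq) =
      cong (λ v → inj₁ (i , v)) (+-cancelʳ-≡ (n ∸ (D + i)) u u′ (cong proj₂ eq))
    inj {inj₂ (j , r)} {inj₂ (j′ , r′)} a∈ b∈ eq
      with refl ← trans (sym (Sparse.residue a∈)) (trans (cong (_% suc D) (cong proj₁ eq)) (Sparse.residue b∈)) =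
      cong (λ v → inj₂ (v , r)) (suc-injective (*-cancelʳ-≡ (suc j) (suc j′) (suc D)
        (+-cancelˡ-≡ r _ _ (cong proj₁ eq))))
    inj {inj₁ (i , u)} {inj₂ (j , r)} a∈ b∈ eq = ⊥-elim (<-irrefl
      (+-cancelˡ-≡ n u D (trans (sym (Full.sum a∈)) (trans (cong (λ (x , y) → x + y) eq) (Sparse.sum b∈))))
      (Full.u<D a∈))
    inj {inj₂ (j , r)} {inj₁ (i , u)} a∈ b∈ eq = ⊥-elim (<-irrefl
      (sym (+-cancelˡ-≡ n D u (trans (sym (Sparse.sum a∈)) (trans (cong (λ (x , y) → x + y) eq) (Full.sum b∈)))))
      (Full.u<D b∈))

-- The asymptotics of La

2*suc-S : ∀ d → 2 * suc (S (suc d)) ≡ suc d * suc (suc d)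
2*suc-S zero    = refl
2*suc-S (suc d) = trans (split (S (suc d)) d) (trans (cong (_+ 2 * suc (suc d)) (2*suc-S d)) (merge d))
  where
  split : ∀ a d → 2 * suc (a + suc (suc d)) ≡ 2 * suc a + 2 * suc (suc d)
  split = solve-∀
  merge : ∀ d → suc d * suc (suc d) + 2 * suc (suc d) ≡ suc (suc d) * suc (suc (suc d))
  merge = solve-∀

module Density (s d : ℕ) (ks : IsKs s (suc d)) where

  -- The density is W/(D + 1). In E, the first term accounts for the D columns omitted from each
  -- full antidiagonal, the second for the incomplete period and the dropped block; both are scaled
  -- by D + 1.
  D c W E : ℕ
  D = suc d
  c = cs s D
  W = D * suc D + c
  E = suc D * D * D + c * (D + suc D)

  s≡ : suc (S D) + c ≡ s
  s≡ with S<s ← proj₁ (proj₂ ks) = trans (cong (λ a → suc (S D) + a) (∸-+-assoc s 1 (S D))) (m+[n∸m]≡n S<s)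

  -- Maximality of k_s gives s ≤ S (D + 1) = S D + D + 1.
  c≤ : c ≤ suc D
  c≤ = +-cancelˡ-≤ (suc (S D)) c (suc D) (≤-trans (≤-reflexive s≡) (≤-trans s≤ (n≤1+n _)))
    where
    s≤ : s ≤ S (suc D)
    s≤ = ≮⇒≥ λ S<s → 1+n≰n (proj₂ (proj₂ ks) (suc D) (s≤s z≤n) S<s)

  -- One triangular number comes from s = 1 + S D + c and one from the isolated pairs; together they
  -- make D(D + 1).
  upper : ∀ {k m} → IsLa k k (vee s) m → suc D * m ≤ W * k
  upper {k} ((F , uniq , free , refl) , _) = ≤-trans (weak-upper d) (≤-reflexive (begin
    k * s + suc (S D) * k                    ≡⟨ cong (λ a → k * a + suc (S D) * k) (sym s≡) ⟩
    k * (suc (S D) + c) + suc (S D) * k      ≡⟨ regroup k (suc (S D)) c ⟩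
    (2 * suc (S D) + c) * k                  ≡⟨ cong (λ a → (a + c) * k) (2*suc-S d) ⟩
    W * k                                    ∎))
    where
    open ≡-Reasoning
    open WeakUpper F uniq free
    regroup : ∀ k a c → k * (a + c) + a * k ≡ (2 * a + c) * k
    regroup = solve-∀

  lower : ∀ {k m} → IsLa k k (vee s) m → W * k ≤ suc D * m + E
  lower {zero}      _         = ≤-trans (≤-reflexive (*-zeroʳ W)) z≤n
  lower {suc n} {m} (_ , max) = begin
    W * k
      ≡⟨ *-distribʳ-+ k (D * suc D) c ⟩
    D * suc D * k + c * k
      ≤⟨ +-mono-≤ (*-monoʳ-≤ (D * suc D) (m≤n+m∸n k D)) (*-monoʳ-≤ c k≤) ⟩
    D * suc D * (D + (k ∸ D)) + c * (D + suc blocks * suc D)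
      ≡⟨ regroup D c (k ∸ D) blocks ⟩
    suc D * ((k ∸ D) * D + blocks * c) + E
      ≤⟨ +-monoˡ-≤ E (*-monoʳ-≤ (suc D) (≤-trans stair-size (max stair stair-unique stair-free))) ⟩
    suc D * m + E
      ∎
    where
    open ≤-Reasoning
    open Staircase n d c c≤ hiding (D)
    k = suc n
    stair-free : WeakFree (vee s) stair
    stair-free = subst (λ s → WeakFree (vee s) stair) s≡ stair-vee-free
    k≤ : k ≤ D + suc blocks * suc D
    k≤ = begin
      k                                ≡⟨ m≡m%n+[m/n]*n k (suc D) ⟩
      k % suc D + k /ℕ suc D * suc D    ≤⟨ +-mono-≤ (≤-pred (m%n<n k (suc D))) (*-monoˡ-≤ (suc D) (m≤n+m∸n (k /ℕ suc D) 1)) ⟩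
      D + suc blocks * suc D           ∎
    regroup : ∀ D c a b → D * suc D * (D + a) + c * (D + suc b * suc D) ≡
      suc D * (a * D + b * c) + (suc D * D * D + c * (D + suc D))
    regroup = solve-∀

-- The operation `_/_` reduces to lowest terms. Unnormalised rationals keep the given numerator and
-- denominator, so that inequalities become cross-multiplications.
toℚᵘ-/ : ∀ n d → toℚᵘ (+ n / suc d) ≃ᵘ mkℚᵘ (+ n) d
toℚᵘ-/ n d = toℚᵘ-fromℚᵘ (mkℚᵘ (+ n) d)

toℚᵘ-/-* : ∀ w d k → toℚᵘ ((+ w / suc d) *ℚ (+ k / 1)) ≃ᵘ mkℚᵘ (+ (w * k)) d
toℚᵘ-/-* w d k = begin
  toℚᵘ ((+ w / suc d) *ℚ (+ k / 1))          ≈⟨ toℚᵘ-homo-* (+ w / suc d) (+ k / 1) ⟩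
  toℚᵘ (+ w / suc d) *ᵘ toℚᵘ (+ k / 1)       ≈⟨ ℚᵘₚ.*-cong (toℚᵘ-/ w d) (toℚᵘ-/ k 0) ⟩
  mkℚᵘ (+ w) d *ᵘ mkℚᵘ (+ k) 0               ≈⟨ *≡*ᵘ (cong₂ ℤ._*_ (sym (ℤₚ.pos-* w k)) (cong +_ (sym (*-identityʳ (suc d))))) ⟩
  mkℚᵘ (+ (w * k)) d                         ∎
  where open import Relation.Binary.Reasoning.Setoid ℚᵘₚ.≃-setoid

-- The upper bound for La carries no error term, so the deviation from the density is one-sided.
∣-∣-≤ : ∀ {a b e} → a ≤ℚ b → b ≤ℚ a +ℚ e → ∣ a - b ∣ ≤ℚ e
∣-∣-≤ {a} {b} {e} a≤b b≤a+e = begin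
  ∣ a - b ∣        ≡⟨ ∣-p∣≡∣p∣ (a - b) ⟨
  ∣ -ℚ (a - b) ∣   ≡⟨ cong ∣_∣ (⁻¹-anti-homo-// a b) ⟩
  ∣ b - a ∣        ≡⟨ 0≤p⇒∣p∣≡p (subst (_≤ℚ b - a) (ℚₚ.+-inverseʳ a) (ℚₚ.+-monoˡ-≤ (-ℚ a) a≤b)) ⟩
  b - a            ≤⟨ ℚₚ.+-monoˡ-≤ (-ℚ a) b≤a+e ⟩
  a +ℚ e - a       ≡⟨ xyx⁻¹≈y a e ⟩
  e                ∎
  where
  open ℚₚ.≤-Reasoning
  open import Algebra.Properties.AbelianGroup ℚₚ.+-0-abelianGroup using (⁻¹-anti-homo-//; xyx⁻¹≈y)

n/1≤w/d*k : ∀ {n w d k} → suc d * n ≤ w * k → + n / 1 ≤ℚ (+ w / suc d) *ℚ (+ k / 1)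
n/1≤w/d*k {n} {w} {d} {k} h = toℚᵘ-cancel-≤ (begin
  toℚᵘ (+ n / 1)                       ≃⟨ toℚᵘ-/ n 0 ⟩
  mkℚᵘ (+ n) 0                         ≤⟨ *≤*ᵘ (subst₂ ℤ._≤_ (ℤₚ.pos-* n (suc d)) (ℤₚ.pos-* (w * k) 1) (ℤ.+≤+ h′)) ⟩
  mkℚᵘ (+ (w * k)) d                   ≃⟨ ℚᵘₚ.≃-sym (toℚᵘ-/-* w d k) ⟩
  toℚᵘ ((+ w / suc d) *ℚ (+ k / 1))    ∎)
  where
  open ℚᵘₚ.≤-Reasoning
  h′ : n * suc d ≤ w * k * 1
  h′ = subst₂ _≤_ (*-comm (suc d) n) (sym (*-identityʳ (w * k))) h

w/d*k≤n/1 : ∀ {n w d k} → w * k ≤ suc d * n → (+ w / suc d) *ℚ (+ k / 1) ≤ℚ + n / 1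
w/d*k≤n/1 {n} {w} {d} {k} h = toℚᵘ-cancel-≤ (begin
  toℚᵘ ((+ w / suc d) *ℚ (+ k / 1))    ≃⟨ toℚᵘ-/-* w d k ⟩
  mkℚᵘ (+ (w * k)) d                   ≤⟨ *≤*ᵘ (subst₂ ℤ._≤_ (ℤₚ.pos-* (w * k) 1) (ℤₚ.pos-* n (suc d)) (ℤ.+≤+ h′)) ⟩
  mkℚᵘ (+ n) 0                         ≃⟨ ℚᵘₚ.≃-sym (toℚᵘ-/ n 0) ⟩
  toℚᵘ (+ n / 1)                       ∎)
  where
  open ℚᵘₚ.≤-Reasoning
  h′ : w * k * 1 ≤ n * suc d
  h′ = subst₂ _≤_ (sym (*-identityʳ (w * k))) (*-comm (suc d) n) h

/1-homo-+ : ∀ m n → + (m + n) / 1 ≡ (+ m / 1) +ℚ (+ n / 1)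
/1-homo-+ m n = toℚᵘ-injective (begin
  toℚᵘ (+ (m + n) / 1)                 ≈⟨ toℚᵘ-/ (m + n) 0 ⟩
  mkℚᵘ (+ (m + n)) 0                   ≈⟨ *≡*ᵘ (cong (ℤ._* + 1) (sym (cong₂ ℤ._+_ (ℤₚ.*-identityʳ (+ m)) (ℤₚ.*-identityʳ (+ n))))) ⟩
  mkℚᵘ (+ m) 0 +ᵘ mkℚᵘ (+ n) 0         ≈⟨ ℚᵘₚ.≃-sym (ℚᵘₚ.+-cong (toℚᵘ-/ m 0) (toℚᵘ-/ n 0)) ⟩
  toℚᵘ (+ m / 1) +ᵘ toℚᵘ (+ n / 1)     ≈⟨ ℚᵘₚ.≃-sym (toℚᵘ-homo-+ (+ m / 1) (+ n / 1)) ⟩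
  toℚᵘ ((+ m / 1) +ℚ (+ n / 1))        ∎)
  where open import Relation.Binary.Reasoning.Setoid ℚᵘₚ.≃-setoid

archimedean : ∀ e (ε : ℚ) → 0ℚ <ℚ ε → ∃ λ K → ∀ k → K ≤ k → + e / 1 ≤ℚ ε *ℚ (+ k / 1)
-- For ε = (n + 1)/(d + 1) the claim reads (d + 1)e ≤ (n + 1)k.
archimedean e ε@(mkℚ +[1+ n ] d _) _ = suc d * e , λ k K≤k →
  subst (λ ε → + e / 1 ≤ℚ ε *ℚ (+ k / 1)) (fromℚᵘ-toℚᵘ ε)
    (n/1≤w/d*k {e} {suc n} {d} {k} (≤-trans K≤k (m≤m+n k (n * k))))
archimedean e (mkℚ (+ zero) d _) (*<* (ℤ.+<+ ()))
archimedean e (mkℚ ℤ.-[1+ n ] d _) (*<* ())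

La-asymptotics : ∀ s → 1 ≤ s → ∀ kₛ → IsKs s kₛ →
  ∀ (ε : ℚ) → 0ℚ <ℚ ε → ∃ λ K → ∀ k → K ≤ k → ∀ m → IsLa k k (vee s) m →
  ∣ (+ m / 1) - ((+ (kₛ * suc kₛ + cs s kₛ) / suc kₛ) *ℚ (+ k / 1)) ∣ ≤ℚ ε *ℚ (+ k / 1)
La-asymptotics s _ zero    (() , _) ε 0<ε
La-asymptotics s _ (suc d) ks       ε 0<ε with archimedean (Density.E s d ks) ε 0<ε
... | K , E≤εk = K , λ k K≤k m La → ∣-∣-≤
  (n/1≤w/d*k {m} {W} {D} {k} (upper La))
  -- Since E ≤ (D + 1)E, the integer E can replace the error E/(D + 1).
  (ℚₚ.≤-trans (w/d*k≤n/1 {m + E} {W} {D} {k} (≤-trans (lower La)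
      (≤-trans (+-monoʳ-≤ (suc D * m) (m≤m+n E (D * E))) (≤-reflexive (sym (*-distribˡ-+ (suc D) m E))))))
    (ℚₚ.≤-trans (ℚₚ.≤-reflexive (/1-homo-+ m E)) (ℚₚ.+-monoʳ-≤ (+ m / 1) (E≤εk k K≤k))))
  where open Density s d ks

theorem1p5 : (∀ s → 1 ≤ s → ∀ kₛ → IsKs s kₛ →
    ∀ (ε : ℚ) → 0ℚ <ℚ ε → ∃ λ K → ∀ k → K ≤ k → ∀ m → IsLa k k (vee s) m →
    ∣ (+ m / 1) - ((+ (kₛ * suc kₛ + cs s kₛ) / suc kₛ) *ℚ (+ k / 1)) ∣
    ≤ℚ ε *ℚ (+ k / 1))
    × (∀ k l → 1 ≤ k → 1 ≤ l → IsLaStar k l (vee 2) (k + l ∸ 1))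
    × (∀ k l → 2 ≤ k → 2 ≤ l → IsLaStar k l (vee 3) (2 * (k + l) ∸ 4))
    × (∃ λ C → ∀ s → 1 ≤ s → ∀ k m → IsLaStar k k (vee s) m →
    2 * (s ∸ 1) * k ≤ m + C * (s * s))
    × (∀ k l → 1 ≤ k → 1 ≤ l → IsLaStar₂ k l (vee 2) wedge2 (k + l ∸ 1))
theorem1p5 = La-asymptotics , La*-vee2 , La*-vee3 , La*-vee-lower , La*-vee2-wedge2
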